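{- Let $q=p^s$ with $p$ an odd prime and $s\ge1$, let $k\geq1$ be an integer, let $b\in\mathbb{F}_q^*$, and let $$\widetilde N^*(k,b)=\#\{(x_1,\dots,x_k)\in(\mathbb{F}_q^*)^k\mid x_1^2+\cdots+x_k^2=b,\ x_i\ne x_j\text{ for all }i\neq j\}.$$ (1) If either $p\equiv1\pmod4$, or $p\equiv3\pmod4$ and $s$ is even, then $$\widetilde N^*(k,b)=\frac{(q-1)_k}{q}-\frac{(-1)^k}{2q}\Big\{(1-\sqrt q)A_{k,b}(1-\sqrt q,1+\sqrt q,1-q)+(1+\sqrt q)A_{k,b}(1+\sqrt q,1-\sqrt q,1-q)\Big\}.$$ (2) If $p\equiv3\pmod4$ and $s$ is odd, then $$\widetilde N^*(k,b)=\frac{(q-1)_k}{q}-\frac{(-1)^k}{2q}\Big\{(1+\sqrt q i)A_{k,b}(1-\sqrt q i,1+\sqrt q i,1-q)+(1-\sqrt q i)A_{k,b}(1+\sqrt q i,1-\sqrt q i,1-q)\Big\},$$ where $i=\sqrt{ -1}$.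
   Context: $(x)_k=x(x-1)\cdots(x-k+1)$. $\chi$ denotes the quadratic character of $\mathbb{F}_q^*$, and for an integer $j$, $\chi(j)$ means $\chi$ evaluated at the image of $j$ in $\mathbb{F}_q$. For integers $c_1,\dots,c_k\geq 0$ with $\sum_j jc_j=k$, let $N(c_1,\dots,c_k)=\frac{k!}{1^{c_1}c_1!\,2^{c_2}c_2!\cdots k^{c_k}c_k!}$. For $b\in\mathbb{F}_q^*$ and complex $u,v,w$, define $$A_{k,b}(u,v,w)=\sum_{c_1,\dots,c_k\ge 0,\ \sum_j jc_j=k}N(c_1,\dots,c_k)\,t_1^{c_1}\cdots t_k^{c_k},$$ where $t_j=u$ if $p\nmid j$ and $\chi(j)=\chi(b)$; $t_j=v$ if $p\nmid j$ and $\chi(j)=-\chi(b)$; $t_j=w$ if $p\mid j$. -}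

module Defs where

open import Level using (0ℓ)
open import Data.Nat as ℕ using (ℕ; zero; suc)

open import Data.Nat.Divisibility using (_∣?_)
open import Data.Integer as ℤ using (ℤ; +_)
open import Data.Fin as Fin using (Fin)
open import Data.Fin.Properties using () renaming (_≟_ to _≟ᶠ_)
open import Data.List using (List; []; _∷_; map; concatMap; filter; length; foldr; allFin; upTo)
open import Data.Bool.ListAction using (all; any)
open import Data.Bool using (Bool; true; false; _∧_; not; if_then_else_)
open import Data.Product using (∃; _,_)
open import Data.Vec.Functional using () renaming (_∷_ to _∷ᶠ_)
open import Relation.Nullary using (¬_; does)
open import Relation.Binary.PropositionalEquality using (_≡_)
open import Algebra.Structures using (IsCommutativeRing)
open import Function.Bundles using (Inverse)

record FiniteField (q : ℕ) : Set₁ where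
  infixl 6 _+_
  infixl 7 _*_
  field
    Carrier : Set
    _+_ _*_ : Carrier → Carrier → Carrier
    -_      : Carrier → Carrier
    0# 1#   : Carrier
    isCommutativeRing : IsCommutativeRing _≡_ _+_ _*_ -_ 0# 1#
    0≢1     : ¬ (0# ≡ 1#)
    inverse : ∀ x → ¬ (x ≡ 0#) → ∃ λ y → x * y ≡ 1#
    enum    : Inverse (Data.Fin.Properties.≡-setoid q) (Relation.Binary.PropositionalEquality.setoid Carrier)

  open Inverse enum public using (to; from)

  -- decidable equality via the enumeration (from is injective)
  _==_ : Carrier → Carrier → Bool
  x == y = does (from x ≟ᶠ from y)

  elements : List Carrier
  elements = map to (allFin q)

  ι : ℕ → Carrier
  ι zero    = 0#
  ι (suc j) = 1# + ι j

  isSquare : Carrier → Bool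
  isSquare a = any (λ y → (y * y) == a) elements

  χ : Carrier → ℤ
  χ a = if a == 0# then + 0 else (if isSquare a then + 1 else ℤ.- (+ 1))

  sumSq : (k : ℕ) → (Fin k → Carrier) → Carrier
  sumSq zero    x = 0#
  sumSq (suc k) x = x Fin.zero * x Fin.zero + sumSq k (λ i → x (Fin.suc i))

open FiniteField public using (Carrier; 0#)
open FiniteField using (to; _==_; χ; ι; sumSq)

allFuns : (k q : ℕ) → List (Fin k → Fin q)
allFuns zero    q = (λ ()) ∷ []
allFuns (suc k) q = concatMap (λ i → map (λ f → i ∷ᶠ f) (allFuns k q)) (allFin q)

allTuples : ∀ {q} (F : FiniteField q) (k : ℕ) → List (Fin k → Carrier F)
allTuples {q} F k = map (λ f i → to F (f i)) (allFuns k q)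

count : {A : Set} → (A → Bool) → List A → ℕ
count P xs = length (filter (λ x → Data.Bool.T? (P x)) xs)

Nstar : ∀ {q} (F : FiniteField q) (k : ℕ) (b : Carrier F) → ℕ
Nstar F k b = count good (allTuples F k)
  where
  good : (Fin k → Carrier F) → Bool
  good x = all (λ i → not (_==_ F (x i) (0# F))) (allFin k)
         ∧ all (λ i → all (λ j → does (i ≟ᶠ j) Data.Bool.∨ not (_==_ F (x i) (x j))) (allFin k)) (allFin k)
         ∧ _==_ F (sumSq F k x) b

-- The ring ℤ[r] with r² = D (D = q gives ℤ[√q], D = -q gives ℤ[√q i]),
-- realised as the subring {a + b r} of ℂ.

record ℤ[r] : Set where
  constructor _+_r
  field re im : ℤ

module RingR (D : ℤ) where
  infixl 6 _⊕_ _⊖_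
  infixl 7 _⊗_
  _⊕_ : ℤ[r] → ℤ[r] → ℤ[r]
  (a + b r) ⊕ (c + d r) = (a ℤ.+ c) + (b ℤ.+ d) r
  ⊝_ : ℤ[r] → ℤ[r]
  ⊝ (a + b r) = (ℤ.- a) + (ℤ.- b) r
  _⊖_ : ℤ[r] → ℤ[r] → ℤ[r]
  x ⊖ y = x ⊕ (⊝ y)
  _⊗_ : ℤ[r] → ℤ[r] → ℤ[r]
  (a + b r) ⊗ (c + d r) = (a ℤ.* c ℤ.+ b ℤ.* d ℤ.* D) + (a ℤ.* d ℤ.+ b ℤ.* c) r
  emb : ℤ → ℤ[r]
  emb a = a + (+ 0) r
  rt : ℤ[r]
  rt = (+ 0) + (+ 1) r
  𝟙 : ℤ[r]
  𝟙 = emb (+ 1)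
  _^ʳ_ : ℤ[r] → ℕ → ℤ[r]
  x ^ʳ zero  = 𝟙
  x ^ʳ suc n = x ⊗ (x ^ʳ n)

  allVecs : (len bound : ℕ) → List (List ℕ)
  allVecs zero    bound = [] ∷ []
  allVecs (suc n) bound = concatMap (λ c → map (c ∷_) (allVecs n bound)) (upTo (suc bound))

  weightFrom : ℕ → List ℕ → ℕ
  weightFrom j₀ []       = 0
  weightFrom j₀ (c ∷ cs) = j₀ ℕ.* c ℕ.+ weightFrom (suc j₀) cs

  denomFrom : ℕ → List ℕ → ℕ
  denomFrom j₀ []       = 1
  denomFrom j₀ (c ∷ cs) = (j₀ ℕ.^ c) ℕ.* (c ℕ.!) ℕ.* denomFrom (suc j₀) cs

  -- exact division (the denominator is never 0 where it is used)
  _div_ : ℕ → ℕ → ℕ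
  n div zero    = 0
  n div (suc d) = n ℕ./ suc d

  Ncount : (k : ℕ) → List ℕ → ℕ
  Ncount k cs = (k ℕ.!) div denomFrom 1 cs

  module _ (p : ℕ) {q : ℕ} (F : FiniteField q) (b : Carrier F) (u v w : ℤ[r]) where
    t : ℕ → ℤ[r]
    t j = if does (p ∣? j) then w
          else (if does (χ F (ι F j) ℤ.≟ χ F b) then u else v)

    monoFrom : ℕ → List ℕ → ℤ[r]
    monoFrom j₀ []       = 𝟙
    monoFrom j₀ (c ∷ cs) = (t j₀ ^ʳ c) ⊗ monoFrom (suc j₀) cs

    A : ℕ → ℤ[r]
    A k = foldr (λ cs acc → (emb (+ Ncount k cs) ⊗ monoFrom 1 cs) ⊕ acc) (emb (+ 0))
                (filter (λ cs → weightFrom 1 cs ℕ.≟ k) (allVecs k k))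

falling : ℤ → ℕ → ℤ
falling x zero    = + 1
falling x (suc k) = falling x k ℤ.* (x ℤ.- + k)

sgn : ℕ → ℤ
sgn zero    = + 1
sgn (suc k) = ℤ.- sgn k

{-# OPTIONS --safe #-}
module Submission where

-- No roots of unity are needed. In the group ring of (F, +) the element counting the values i x² over x ≠ 0
-- is T - 1 + χ(i) Q (or (q - 1) 1 when p ∣ i), where T sums all elements and Q = Σ χ(a) [a]. Since T² = q T,
-- T Q = 0 and Q² = χ(-1) (q - T), the span of 1, T, Q embeds into ℤ × ℤ[r] with r² = χ(-1) q, by T ↦ (q, 0) and
-- Q ↦ (0, r). The counts of distinct tuples are k! e_k of the elements [x²], and so obey Newton's identities
-- over these power sums. The first component of their image is (q - 1)_k; in the second, the identities are the
-- recursion of the cycle index A, obtained by removing one cycle from a cycle type. The Jacobi sum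
-- Σ χ(z) χ(1 - z) = -χ(-1), read modulo 4, gives the sign of χ(-1).

open import Level using (0ℓ)
open import Algebra.Bundles using (CommutativeSemiring; CommutativeRing)
open import Data.Nat as ℕ using (ℕ; zero; suc)
open import Data.Fin as Fin using (Fin)
open import Data.List using (List; []; _∷_; _++_; map; concatMap; allFin; tabulate; applyUpTo)
open import Function using (_∘_; id; Inverse; Equivalence)

-- An element of the span with components f and y = a + g r is a 1 + ((f - a) / q) T + g Q. Reading
-- off coefficients thus divides by q, and every identity is stated for q times a count. The second
-- component is computed once, independently of b; the target enters only with the coefficient of
-- [b], which is (f - a + q χ(b) g) / q because b is not 0. Up to the sign (-1)^k the two values of
-- A in the theorem are y with r replaced by χ(b) r and by -χ(b) r. For e = χ(-1) one has e r² = q,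
-- so the coefficients 1 - e r and 1 + e r combine them to 2 (a - q χ(b) g): this is the origin of
-- the outer factors and of the 2 in the denominator. The obstacle on the side of A is its
-- definition. It sums over a box of exponent vectors that depends on k, and its numbers N are
-- truncated quotients. So integrality of N has to be proved along with the recursion, and the cycle
-- types of all smaller weights have to be found in one fixed box.

-- Finite sums in a commutative semiring.

module Sums (R : CommutativeSemiring 0ℓ 0ℓ) where
  open CommutativeSemiring R
  open import Algebra.Properties.CommutativeSemigroup +-commutativeSemigroup using (interchange)

  private variable
    X Y : Set

  ∑ : List X → (X → Carrier) → Carrier
  ∑ []       f = 0#
  ∑ (x ∷ xs) f = f x + ∑ xs f

  ∑-cong : (xs : List X) {f g : X → Carrier} → (∀ x → f x ≈ g x) → ∑ xs f ≈ ∑ xs g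
  ∑-cong []       f≈g = refl
  ∑-cong (x ∷ xs) f≈g = +-cong (f≈g x) (∑-cong xs f≈g)

  ∑-zero : (xs : List X) → ∑ xs (λ _ → 0#) ≈ 0#
  ∑-zero []       = refl
  ∑-zero (x ∷ xs) = trans (+-identityˡ _) (∑-zero xs)

  ∑-+ : (xs : List X) (f g : X → Carrier) → ∑ xs (λ x → f x + g x) ≈ ∑ xs f + ∑ xs g
  ∑-+ []       f g = sym (+-identityˡ 0#)
  ∑-+ (x ∷ xs) f g = trans (+-congˡ (∑-+ xs f g)) (interchange _ _ _ _)

  ∑-*ˡ : (xs : List X) (a : Carrier) (f : X → Carrier) → ∑ xs (λ x → a * f x) ≈ a * ∑ xs f
  ∑-*ˡ []       a f = sym (zeroʳ a)
  ∑-*ˡ (x ∷ xs) a f = trans (+-congˡ (∑-*ˡ xs a f)) (sym (distribˡ a _ _))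

  ∑-*ʳ : (xs : List X) (a : Carrier) (f : X → Carrier) → ∑ xs (λ x → f x * a) ≈ ∑ xs f * a
  ∑-*ʳ []       a f = sym (zeroˡ a)
  ∑-*ʳ (x ∷ xs) a f = trans (+-congˡ (∑-*ʳ xs a f)) (sym (distribʳ a _ _))

  ∑-swap : (xs : List X) (ys : List Y) (f : X → Y → Carrier) →
           ∑ xs (λ x → ∑ ys (f x)) ≈ ∑ ys (λ y → ∑ xs (λ x → f x y))
  ∑-swap []       ys f = sym (∑-zero ys)
  ∑-swap (x ∷ xs) ys f = trans (+-congˡ (∑-swap xs ys f)) (sym (∑-+ ys _ _))

  ∑-map : (h : Y → X) (ys : List Y) (f : X → Carrier) → ∑ (map h ys) f ≈ ∑ ys (f ∘ h)
  ∑-map h []       f = refl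
  ∑-map h (y ∷ ys) f = +-congˡ (∑-map h ys f)

  ∑-++ : (xs ys : List X) (f : X → Carrier) → ∑ (xs ++ ys) f ≈ ∑ xs f + ∑ ys f
  ∑-++ []       ys f = sym (+-identityˡ _)
  ∑-++ (x ∷ xs) ys f = trans (+-congˡ (∑-++ xs ys f)) (sym (+-assoc _ _ _))

  ∑-concatMap : (h : Y → List X) (ys : List Y) (f : X → Carrier) →
                ∑ (concatMap h ys) f ≈ ∑ ys (λ y → ∑ (h y) f)
  ∑-concatMap h []       f = refl
  ∑-concatMap h (y ∷ ys) f = trans (∑-++ (h y) _ f) (+-congˡ (∑-concatMap h ys f))

  ∑-tabulate : ∀ {n} (h : Fin n → X) (f : X → Carrier) → ∑ (tabulate h) f ≈ ∑ (allFin n) (f ∘ h)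
  ∑-tabulate {n = zero}  h f = refl
  ∑-tabulate {n = suc n} h f =
    +-congˡ (trans (∑-tabulate (h ∘ Fin.suc) f) (sym (∑-tabulate Fin.suc (f ∘ h))))

  ∑< : ℕ → (ℕ → Carrier) → Carrier
  ∑< zero    f = 0#
  ∑< (suc n) f = f 0 + ∑< n (f ∘ suc)

  ∑<-cong : ∀ n {f g : ℕ → Carrier} → (∀ i → i ℕ.< n → f i ≈ g i) → ∑< n f ≈ ∑< n g
  ∑<-cong zero    f≈g = refl
  ∑<-cong (suc n) f≈g = +-cong (f≈g 0 (ℕ.s≤s ℕ.z≤n)) (∑<-cong n (λ i i<n → f≈g (suc i) (ℕ.s≤s i<n)))

  ∑<-zero : ∀ n → ∑< n (λ _ → 0#) ≈ 0#
  ∑<-zero zero    = refl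
  ∑<-zero (suc n) = trans (+-identityˡ _) (∑<-zero n)

  ∑<-*ˡ : ∀ n (a : Carrier) (f : ℕ → Carrier) → ∑< n (λ i → a * f i) ≈ a * ∑< n f
  ∑<-*ˡ zero    a f = sym (zeroʳ a)
  ∑<-*ˡ (suc n) a f = trans (+-congˡ (∑<-*ˡ n a _)) (sym (distribˡ a _ _))

  ∑<-*ʳ : ∀ n (a : Carrier) (f : ℕ → Carrier) → ∑< n (λ i → f i * a) ≈ ∑< n f * a
  ∑<-*ʳ zero    a f = sym (zeroˡ a)
  ∑<-*ʳ (suc n) a f = trans (+-congˡ (∑<-*ʳ n a _)) (sym (distribʳ a _ _))

  ∑-∑<-swap : (xs : List X) (n : ℕ) (f : X → ℕ → Carrier) →
              ∑ xs (λ x → ∑< n (f x)) ≈ ∑< n (λ i → ∑ xs (λ x → f x i))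
  ∑-∑<-swap xs zero    f = ∑-zero xs
  ∑-∑<-swap xs (suc n) f = trans (∑-+ xs _ _) (+-congˡ (∑-∑<-swap xs n (λ x → f x ∘ suc)))

  ∑-applyUpTo : (h : ℕ → X) (n : ℕ) (f : X → Carrier) → ∑ (applyUpTo h n) f ≈ ∑< n (f ∘ h)
  ∑-applyUpTo h zero    f = refl
  ∑-applyUpTo h (suc n) f = +-congˡ (∑-applyUpTo (h ∘ suc) n f)

open import Defs using (FiniteField; ℤ[r]; module RingR; allFuns; allTuples; count; Nstar; falling; sgn) renaming (_+_r to ⟨_+_r⟩)
open import Data.Bool using (Bool; true; false; not; _∧_; _∨_)
open import Data.Fin.Properties using () renaming (_≟_ to _≟ᶠ_)
open import Data.Product using (∃; _×_; _,_; proj₁; proj₂)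
open import Data.Sum using (_⊎_; inj₁; inj₂)
open import Relation.Nullary using (¬_; Dec; yes; no; does; contradiction)
open import Relation.Nullary.Decidable using (map′; dec-true; dec-false)
open import Relation.Binary.PropositionalEquality using (_≡_; refl; sym; trans; cong; cong₂; subst; subst₂; isEquivalence; module ≡-Reasoning)

-- Arithmetic in a finite field.

module FieldProperties {q : ℕ} (F : FiniteField q) where
  open FiniteField F public using (_==_; elements; to; from; inverse; 0≢1)
    renaming (Carrier to C; _+_ to _+ᶠ_; _*_ to _*ᶠ_; -_ to -ᶠ_; 0# to 0ᶠ; 1# to 1ᶠ)

  fieldRing : CommutativeRing 0ℓ 0ℓ
  fieldRing = record { isCommutativeRing = FiniteField.isCommutativeRing F }

  open CommutativeRing fieldRing public using ()
    renaming ( +-assoc to +ᶠ-assoc; +-comm to +ᶠ-comm; +-identityˡ to +ᶠ-identityˡ; +-identityʳ to +ᶠ-identityʳ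
             ; -‿inverseʳ to -ᶠ-inverseʳ; -‿inverseˡ to -ᶠ-inverseˡ
             ; *-assoc to *ᶠ-assoc; *-comm to *ᶠ-comm; *-identityˡ to *ᶠ-identityˡ; *-identityʳ to *ᶠ-identityʳ
             ; distribˡ to distribᶠˡ; distribʳ to distribᶠʳ; zeroˡ to zeroᶠˡ; zeroʳ to zeroᶠʳ)
  open CommutativeRing fieldRing using (ring; +-group; +-abelianGroup; *-commutativeSemigroup)
  open import Algebra.Properties.Ring ring public using ()
    renaming (-‿distribˡ-* to -ᶠ-distribˡ; -‿distribʳ-* to -ᶠ-distribʳ; -1*x≈-x to -1*ᶠ; -‿involutive to -ᶠ-involutive; -‿+-comm to -ᶠ-+-comm)
  open import Algebra.Properties.Group +-group using (//-rightDividesˡ; //-rightDividesʳ; inverseˡ-unique; ⁻¹-anti-homo-//)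
  open import Algebra.Properties.AbelianGroup +-abelianGroup using (xyx⁻¹≈y)
  open import Algebra.Properties.CommutativeSemigroup *-commutativeSemigroup using (interchange)
  open ≡-Reasoning

  infixl 6 _-ᶠ_
  _-ᶠ_ : C → C → C
  x -ᶠ y = x +ᶠ (-ᶠ y)

  to∘from : ∀ x → to (from x) ≡ x
  to∘from x = Inverse.inverseˡ (FiniteField.enum F) refl

  from∘to : ∀ i → from (to i) ≡ i
  from∘to i = Inverse.inverseʳ (FiniteField.enum F) refl

  infix 4 _≟_
  _≟_ : (x y : C) → Dec (x ≡ y)
  x ≟ y = map′ (λ e → trans (sym (to∘from x)) (trans (cong to e) (to∘from y))) (cong from) (from x ≟ᶠ from y)

  ==-true : ∀ {x y} → x ≡ y → (x == y) ≡ true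
  ==-true {x} {y} = dec-true (x ≟ y)

  ==-false : ∀ {x y} → ¬ x ≡ y → (x == y) ≡ false
  ==-false {x} {y} = dec-false (x ≟ y)

  ==⇒≡ : ∀ {x y} → (x == y) ≡ true → x ≡ y
  ==⇒≡ {x} {y} e with x ≟ y
  ... | yes p = p
  ... | no ¬p = contradiction (trans (sym e) (==-false ¬p)) λ ()

  ==-cong⇔ : ∀ {x y z w} → (x ≡ y → z ≡ w) → (z ≡ w → x ≡ y) → (x == y) ≡ (z == w)
  ==-cong⇔ {x} {y} f g with x ≟ y
  ... | yes p = trans (==-true p) (sym (==-true (f p)))
  ... | no ¬p = trans (==-false ¬p) (sym (==-false (¬p ∘ g)))

  ==-sym : ∀ x y → (x == y) ≡ (y == x)
  ==-sym x y = ==-cong⇔ sym sym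

  x+c-c : ∀ c x → (x +ᶠ c) -ᶠ c ≡ x
  x+c-c = //-rightDividesʳ

  x-c+c : ∀ c x → (x -ᶠ c) +ᶠ c ≡ x
  x-c+c = //-rightDividesˡ

  c-[c-x] : ∀ c x → c -ᶠ (c -ᶠ x) ≡ x
  c-[c-x] c x = begin
    c +ᶠ (-ᶠ (c -ᶠ x)) ≡⟨ cong (c +ᶠ_) (⁻¹-anti-homo-// c x) ⟩
    c +ᶠ (x -ᶠ c)      ≡⟨ sym (+ᶠ-assoc c x (-ᶠ c)) ⟩
    c +ᶠ x -ᶠ c        ≡⟨ xyx⁻¹≈y c x ⟩
    x                  ∎

  -ᶠ-swap : ∀ c x y → c -ᶠ x -ᶠ y ≡ c -ᶠ y -ᶠ x
  -ᶠ-swap c x y = begin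
    c -ᶠ x -ᶠ y               ≡⟨ +ᶠ-assoc c _ _ ⟩
    c +ᶠ ((-ᶠ x) +ᶠ (-ᶠ y))   ≡⟨ cong (c +ᶠ_) (+ᶠ-comm _ _) ⟩
    c +ᶠ ((-ᶠ y) +ᶠ (-ᶠ x))   ≡⟨ sym (+ᶠ-assoc c _ _) ⟩
    c -ᶠ y -ᶠ x               ∎

  -ᶠ-+ : ∀ c x y → c -ᶠ x -ᶠ y ≡ c -ᶠ (y +ᶠ x)
  -ᶠ-+ c x y = begin
    c -ᶠ x -ᶠ y               ≡⟨ -ᶠ-swap c x y ⟩
    c -ᶠ y -ᶠ x               ≡⟨ +ᶠ-assoc c _ _ ⟩
    c +ᶠ ((-ᶠ y) +ᶠ (-ᶠ x))   ≡⟨ cong (c +ᶠ_) (-ᶠ-+-comm y x) ⟩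
    c -ᶠ (y +ᶠ x)             ∎

  c-0 : ∀ c → c -ᶠ 0ᶠ ≡ c
  c-0 c = trans (cong (_-ᶠ 0ᶠ) (sym (+ᶠ-identityʳ c))) (x+c-c 0ᶠ c)

  x-y≡0⇒x≡y : ∀ {x y} → x -ᶠ y ≡ 0ᶠ → x ≡ y
  x-y≡0⇒x≡y {x} {y} e = trans (sym (x-c+c y x)) (trans (cong (_+ᶠ y) e) (+ᶠ-identityˡ y))

  x+y≡0⇒x≡-y : ∀ {x y} → x +ᶠ y ≡ 0ᶠ → x ≡ -ᶠ y
  x+y≡0⇒x≡-y {x} {y} = inverseˡ-unique x y

  *ᶠ-cancel : ∀ {m n} → m *ᶠ n ≡ 1ᶠ → ∀ x → n *ᶠ (m *ᶠ x) ≡ x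
  *ᶠ-cancel {m} {n} mn x = begin
    n *ᶠ (m *ᶠ x) ≡⟨ sym (*ᶠ-assoc n m x) ⟩
    n *ᶠ m *ᶠ x   ≡⟨ cong (_*ᶠ x) (trans (*ᶠ-comm n m) mn) ⟩
    1ᶠ *ᶠ x       ≡⟨ *ᶠ-identityˡ x ⟩
    x             ∎

  *ᶠ-zero-product : ∀ {x y} → x *ᶠ y ≡ 0ᶠ → ¬ x ≡ 0ᶠ → y ≡ 0ᶠ
  *ᶠ-zero-product {x} {y} xy≡0 x≢0 with inverse x x≢0
  ... | z , xz≡1 = trans (sym (*ᶠ-cancel xz≡1 y)) (trans (cong (z *ᶠ_) xy≡0) (zeroᶠʳ z))

  *ᶠ-≢0 : ∀ {x y} → ¬ x ≡ 0ᶠ → ¬ y ≡ 0ᶠ → ¬ x *ᶠ y ≡ 0ᶠ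
  *ᶠ-≢0 x≢0 y≢0 e = y≢0 (*ᶠ-zero-product e x≢0)

  x²≡0⇒x≡0 : ∀ {x} → x *ᶠ x ≡ 0ᶠ → x ≡ 0ᶠ
  x²≡0⇒x≡0 {x} e with x ≟ 0ᶠ
  ... | yes p = p
  ... | no ¬p = *ᶠ-zero-product e ¬p

  *ᶠ-square : ∀ x y → (x *ᶠ y) *ᶠ (x *ᶠ y) ≡ (x *ᶠ x) *ᶠ (y *ᶠ y)
  *ᶠ-square x y = interchange x y x y

  *ᶠ-distrib-- : ∀ m c a → m *ᶠ (c -ᶠ a) ≡ m *ᶠ c -ᶠ m *ᶠ a
  *ᶠ-distrib-- m c a = trans (distribᶠˡ m c _) (cong (m *ᶠ c +ᶠ_) (sym (-ᶠ-distribʳ m a)))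

  -ᶠ-square : ∀ x → (-ᶠ x) *ᶠ (-ᶠ x) ≡ x *ᶠ x
  -ᶠ-square x = trans (sym (-ᶠ-distribˡ x (-ᶠ x))) (trans (cong -ᶠ_ (sym (-ᶠ-distribʳ x x))) (-ᶠ-involutive (x *ᶠ x)))

  x²≡y²⇒x≡±y : ∀ {x y} → x *ᶠ x ≡ y *ᶠ y → x ≡ y ⊎ x ≡ -ᶠ y
  x²≡y²⇒x≡±y {x} {y} e with x ≟ y
  ... | yes p = inj₁ p
  ... | no ¬p = inj₂ (x+y≡0⇒x≡-y (*ᶠ-zero-product prod (¬p ∘ x-y≡0⇒x≡y)))
    where
    prod : (x -ᶠ y) *ᶠ (x +ᶠ y) ≡ 0ᶠ
    prod = begin
      (x -ᶠ y) *ᶠ (x +ᶠ y)                   ≡⟨ distribᶠʳ (x +ᶠ y) x (-ᶠ y) ⟩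
      x *ᶠ (x +ᶠ y) +ᶠ (-ᶠ y) *ᶠ (x +ᶠ y)    ≡⟨ cong₂ _+ᶠ_ (distribᶠˡ x x y) (sym (-ᶠ-distribˡ y (x +ᶠ y))) ⟩
      (x *ᶠ x +ᶠ x *ᶠ y) -ᶠ y *ᶠ (x +ᶠ y)    ≡⟨ cong₂ (λ a b → (a +ᶠ x *ᶠ y) -ᶠ b) e (distribᶠˡ y x y) ⟩
      (y *ᶠ y +ᶠ x *ᶠ y) -ᶠ (y *ᶠ x +ᶠ y *ᶠ y) ≡⟨ cong (λ a → (y *ᶠ y +ᶠ a) -ᶠ (y *ᶠ x +ᶠ y *ᶠ y)) (*ᶠ-comm x y) ⟩
      (y *ᶠ y +ᶠ y *ᶠ x) -ᶠ (y *ᶠ x +ᶠ y *ᶠ y) ≡⟨ cong (_-ᶠ (y *ᶠ x +ᶠ y *ᶠ y)) (+ᶠ-comm _ _) ⟩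
      (y *ᶠ x +ᶠ y *ᶠ y) -ᶠ (y *ᶠ x +ᶠ y *ᶠ y) ≡⟨ -ᶠ-inverseʳ _ ⟩
      0ᶠ                                     ∎

-- Sums over all elements of the field.

module FieldSums {q : ℕ} (F : FiniteField q) (R : CommutativeSemiring 0ℓ 0ℓ) where
  open FieldProperties F
  open Sums R public
  open CommutativeSemiring R hiding (refl; sym; trans) renaming (Carrier to V)
  module ≈ = CommutativeSemiring R
  open import Relation.Binary.Reasoning.Setoid setoid

  ind : Bool → V
  ind true  = 1#
  ind false = 0#

  δ : C → C → V
  δ x y = ind (x == y)

  δ-≡ : ∀ {x y} → x ≡ y → δ x y ≡ 1#
  δ-≡ x≡y = cong ind (==-true x≡y)

  δ-≢ : ∀ {x y} → ¬ x ≡ y → δ x y ≡ 0#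
  δ-≢ x≢y = cong ind (==-false x≢y)

  ΣF : (C → V) → V
  ΣF = ∑ elements

  ∑-allFin-δ : ∀ {n} (j : Fin n) (g : Fin n → V) → ∑ (allFin n) (λ i → ind (does (i ≟ᶠ j)) * g i) ≈ g j
  ∑-allFin-δ {suc n} Fin.zero g = begin
    1# * g Fin.zero + ∑ (Data.List.tabulate Fin.suc) h ≈⟨ +-cong (*-identityˡ _) (∑-tabulate Fin.suc h) ⟩
    g Fin.zero + ∑ (allFin n) (λ i → 0# * g (Fin.suc i)) ≈⟨ +-congˡ (∑-cong (allFin n) (λ i → zeroˡ _)) ⟩
    g Fin.zero + ∑ (allFin n) (λ i → 0#)                 ≈⟨ +-congˡ (∑-zero (allFin n)) ⟩
    g Fin.zero + 0#                                      ≈⟨ +-identityʳ _ ⟩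
    g Fin.zero                                           ∎
    where h = λ i → ind (does (i ≟ᶠ Fin.zero)) * g i
  ∑-allFin-δ {suc n} (Fin.suc j) g = begin
    0# * g Fin.zero + ∑ (Data.List.tabulate Fin.suc) h ≈⟨ +-cong (zeroˡ _) (∑-tabulate Fin.suc h) ⟩
    0# + ∑ (allFin n) (h ∘ Fin.suc)                      ≈⟨ +-identityˡ _ ⟩
    ∑ (allFin n) (h ∘ Fin.suc)                           ≈⟨ ∑-allFin-δ j (g ∘ Fin.suc) ⟩
    g (Fin.suc j)                                        ∎
    where h = λ i → ind (does (i ≟ᶠ Fin.suc j)) * g i

  ΣF-δ : ∀ a (f : C → V) → ΣF (λ x → δ x a * f x) ≈ f a
  ΣF-δ a f = begin
    ΣF (λ x → δ x a * f x)                        ≈⟨ ∑-map to (allFin q) _ ⟩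
    ∑ (allFin q) (λ i → δ (to i) a * f (to i))
      ≈⟨ ∑-cong (allFin q) (λ i → reflexive (cong (λ j → ind (does (j ≟ᶠ from a)) * f (to i)) (from∘to i))) ⟩
    ∑ (allFin q) (λ i → ind (does (i ≟ᶠ from a)) * f (to i)) ≈⟨ ∑-allFin-δ (from a) (f ∘ to) ⟩
    f (to (from a))                               ≡⟨ cong f (to∘from a) ⟩
    f a                                           ∎

  ΣF-δ₁ : ∀ a → ΣF (λ x → δ x a) ≈ 1#
  ΣF-δ₁ a = ≈.trans (∑-cong elements (λ x → ≈.sym (*-identityʳ _))) (ΣF-δ a (λ _ → 1#))

  -- Sorts the `x` by their image. With squaring for `g` the fibre sizes become `1 + χ a`, which is
  -- how sums over squares turn into character sums.
  ΣF-fibre : ∀ (g : C → C) (f : C → V) → ΣF (λ x → f (g x)) ≈ ΣF (λ a → ΣF (λ x → δ a (g x)) * f a)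
  ΣF-fibre g f = begin
    ΣF (λ x → f (g x))                       ≈⟨ ∑-cong elements (λ x → ≈.sym (ΣF-δ (g x) f)) ⟩
    ΣF (λ x → ΣF (λ a → δ a (g x) * f a))    ≈⟨ ∑-swap elements elements _ ⟩
    ΣF (λ a → ΣF (λ x → δ a (g x) * f a))    ≈⟨ ∑-cong elements (λ a → ∑-*ʳ elements (f a) _) ⟩
    ΣF (λ a → ΣF (λ x → δ a (g x)) * f a)    ∎

  -- Every fibre of a bijection has one element, so `ΣF-fibre` applies and the list `elements` never
  -- has to be compared with a permutation of itself.
  ΣF-bijection : (σ τ : C → C) → (∀ x → τ (σ x) ≡ x) → (∀ x → σ (τ x) ≡ x) →
                 ∀ f → ΣF (λ x → f (σ x)) ≈ ΣF f
  ΣF-bijection σ τ τσ στ f = begin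
    ΣF (λ x → f (σ x))                       ≈⟨ ΣF-fibre σ f ⟩
    ΣF (λ a → ΣF (λ x → δ a (σ x)) * f a)    ≈⟨ ∑-cong elements (λ a → *-congʳ (fibre≈1 a)) ⟩
    ΣF (λ a → 1# * f a)                      ≈⟨ ∑-cong elements (λ a → *-identityˡ _) ⟩
    ΣF f                                     ∎
    where
    fibre≈1 : ∀ a → ΣF (λ x → δ a (σ x)) ≈ 1#
    fibre≈1 a = ≈.trans
      (∑-cong elements (λ x → reflexive (cong ind
        (==-cong⇔ (λ a≡σx → trans (sym (τσ x)) (cong τ (sym a≡σx))) (λ x≡τa → trans (sym (στ a)) (cong σ (sym x≡τa)))))))
      (ΣF-δ₁ (τ a))

open import Algebra.Structures using (IsCommutativeRing; IsCommutativeSemiring)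
open import Data.Bool.ListAction using (all)
open import Data.Bool.Properties using (T-≡; ∧-comm; ∧-assoc)
open import Data.Nat using (pred; _^_; _%_; _∸_; _!; _≤_; _<_; z≤n; s≤s; NonZero)
import Data.Nat.Properties as ℕₚ
open import Data.Nat.Coprimality using (Coprime; coprime-Bézout)
open import Data.Nat.DivMod using (m*n/n≡m; %-distribˡ-*; m≡m%n+[m/n]*n)
open import Data.Nat.Divisibility using (_∣_; _∣?_; divides; ∣⇒≤)
open import Data.Nat.GCD using (module Bézout)
open import Data.Nat.Primality using (Prime; prime⇒irreducible; ¬prime[1])
import Data.Nat.Tactic.RingSolver as ℕ-Solver
import Data.Integer
open import Data.Integer as ℤ using (ℤ; +_; _+_; _*_; _-_; -_; ∣_∣; 0ℤ; 1ℤ; -1ℤ; +≤+; ≢-nonZero)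
import Data.Integer.Properties as ℤₚ
open import Algebra.Properties.AbelianGroup ℤₚ.+-0-abelianGroup using () renaming (∙-cancelˡ to +-cancelˡ)
open import Data.Integer.Tactic.RingSolver using (solve-∀)
open import Data.List using (length; filter; foldr; replicate; upTo)
open import Data.List.Properties using (length-map; length-tabulate)
open import Data.List.Relation.Unary.Any as Any using (here; there)
open import Data.List.Relation.Unary.Any.Properties using (any⁺; any⁻)
open import Data.List.Membership.Propositional using (_∈_; lose)
open import Data.List.Membership.Propositional.Properties using (∈-map⁺; ∈-allFin)
open import Data.Vec.Functional using () renaming (_∷_ to _∷ᶠ_)
open ℤ[r] using (re; im)

length-elements : ∀ {q} (F : FiniteField q) → length (FiniteField.elements F) ≡ q
length-elements {q} F = trans (length-map _ (allFin q)) (length-tabulate id)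

-- Makes the factor `q - 1` cancellable when the Jacobi sum is computed in `J-1`.
q≢1 : ∀ {q} → FiniteField q → ¬ q ≡ 1
q≢1 F refl = 0≢1 (trans (sym (to∘from 0ᶠ)) (trans (cong to (all-equal (from 0ᶠ) (from 1ᶠ))) (to∘from 1ᶠ)))
  where
  open FieldProperties F
  all-equal : (i j : Fin 1) → i ≡ j
  all-equal Fin.zero Fin.zero = refl

-- The characteristic of a field of prime power order.

module Characteristic {q : ℕ} (F : FiniteField q) where
  open FieldProperties F
  open FiniteField F using (ι)
  open FieldSums F (CommutativeRing.commutativeSemiring fieldRing)
  open import Algebra.Properties.Group (CommutativeRing.+-group fieldRing) using (identityʳ-unique)
  open ≡-Reasoning

  ι-+ : ∀ m n → ι (m ℕ.+ n) ≡ ι m +ᶠ ι n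
  ι-+ zero    n = sym (+ᶠ-identityˡ _)
  ι-+ (suc m) n = trans (cong (1ᶠ +ᶠ_) (ι-+ m n)) (sym (+ᶠ-assoc 1ᶠ _ _))

  ι-* : ∀ m n → ι (m ℕ.* n) ≡ ι m *ᶠ ι n
  ι-* zero    n = sym (zeroᶠˡ _)
  ι-* (suc m) n = begin
    ι (n ℕ.+ m ℕ.* n)           ≡⟨ ι-+ n (m ℕ.* n) ⟩
    ι n +ᶠ ι (m ℕ.* n)          ≡⟨ cong₂ _+ᶠ_ (sym (*ᶠ-identityˡ _)) (ι-* m n) ⟩
    1ᶠ *ᶠ ι n +ᶠ ι m *ᶠ ι n     ≡⟨ sym (distribᶠʳ (ι n) 1ᶠ (ι m)) ⟩
    ι (suc m) *ᶠ ι n            ∎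

  ∑-1 : {X : Set} (xs : List X) → ∑ xs (λ _ → 1ᶠ) ≡ ι (length xs)
  ∑-1 []       = refl
  ∑-1 (x ∷ xs) = cong (1ᶠ +ᶠ_) (∑-1 xs)

  -- The sum of all elements is invariant under the translation by 1.
  ιq≡0 : ι q ≡ 0ᶠ
  ιq≡0 = trans (cong ι (sym (length-elements F))) (trans (sym (∑-1 elements)) (identityʳ-unique (ΣF id) _ (begin
    ΣF id +ᶠ ΣF (λ _ → 1ᶠ) ≡⟨ sym (∑-+ elements id _) ⟩
    ΣF (λ x → x +ᶠ 1ᶠ)     ≡⟨ ΣF-bijection (_+ᶠ 1ᶠ) (_-ᶠ 1ᶠ) (x+c-c 1ᶠ) (x-c+c 1ᶠ) id ⟩
    ΣF id                  ∎)))

  -- A field has no zero divisors, and the exponent 0 would give 1 = 0. Together with `ιq≡0` this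
  -- identifies the characteristic.
  ι[m^n]≡0 : ∀ m n → ι (m ℕ.^ n) ≡ 0ᶠ → ι m ≡ 0ᶠ
  ι[m^n]≡0 m zero    e = contradiction (trans (sym e) (+ᶠ-identityʳ 1ᶠ)) 0≢1
  ι[m^n]≡0 m (suc n) e with ι m ≟ 0ᶠ
  ... | yes ιm≡0 = ιm≡0
  ... | no  ιm≢0 = ι[m^n]≡0 m n (*ᶠ-zero-product (trans (sym (ι-* m (m ℕ.^ n))) e) ιm≢0)

  ι-∣ : ∀ {p j} → ι p ≡ 0ᶠ → p ∣ j → ι j ≡ 0ᶠ
  ι-∣ {p} ιp≡0 (divides m refl) = trans (ι-* m p) (trans (cong (ι m *ᶠ_) ιp≡0) (zeroᶠʳ _))

  prime-∤⇒coprime : ∀ {p j} → Prime p → ¬ p ∣ j → Coprime p j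
  prime-∤⇒coprime pr p∤j (d∣p , d∣j) with prime⇒irreducible pr d∣p
  ... | inj₁ d≡1  = d≡1
  ... | inj₂ refl = contradiction d∣j p∤j

  ι-Bézout : ∀ y x j p → ι j ≡ 0ᶠ → ι p ≡ 0ᶠ → 1 ℕ.+ y ℕ.* j ≡ x ℕ.* p → 0ᶠ ≡ 1ᶠ
  ι-Bézout y x j p ιj≡0 ιp≡0 e = begin
    0ᶠ                  ≡⟨ sym (ι-∣ ιp≡0 (divides x refl)) ⟩
    ι (x ℕ.* p)         ≡⟨ cong ι (sym e) ⟩
    1ᶠ +ᶠ ι (y ℕ.* j)   ≡⟨ cong (1ᶠ +ᶠ_) (ι-∣ ιj≡0 (divides y refl)) ⟩
    1ᶠ +ᶠ 0ᶠ            ≡⟨ +ᶠ-identityʳ 1ᶠ ⟩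
    1ᶠ                  ∎

  -- Otherwise a Bézout identity for the coprime numbers `p` and `j` would map to 1 = 0.
  ι-∤ : ∀ {p j} → Prime p → ι p ≡ 0ᶠ → ¬ p ∣ j → ¬ ι j ≡ 0ᶠ
  ι-∤ {p} {j} pr ιp≡0 p∤j ιj≡0 with coprime-Bézout (prime-∤⇒coprime pr p∤j)
  ... | Bézout.+- x y e = 0≢1 (ι-Bézout y x j p ιj≡0 ιp≡0 e)
  ... | Bézout.-+ x y e = 0≢1 (ι-Bézout x y p j ιp≡0 ιj≡0 e)

-- Integer-valued sums and their substitutions.

module IntegerSums {q : ℕ} (F : FiniteField q) where
  open FieldProperties F
  open FieldSums F ℤₚ.+-*-commutativeSemiring public
  open ≡-Reasoning

  ∑-neg : {X : Set} (xs : List X) (f : X → ℤ) → ∑ xs (λ x → - f x) ≡ - ∑ xs f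
  ∑-neg []       f = refl
  ∑-neg (x ∷ xs) f = trans (cong (λ z → - f x + z) (∑-neg xs f)) (sym (ℤₚ.neg-distrib-+ (f x) (∑ xs f)))

  ∑-sub : {X : Set} (xs : List X) (f g : X → ℤ) → ∑ xs (λ x → f x - g x) ≡ ∑ xs f - ∑ xs g
  ∑-sub xs f g = trans (∑-+ xs f _) (cong (λ z → ∑ xs f + z) (∑-neg xs g))

  ∑-1 : {X : Set} (xs : List X) → ∑ xs (λ _ → 1ℤ) ≡ + length xs
  ∑-1 []       = refl
  ∑-1 (x ∷ xs) = cong (λ z → 1ℤ + z) (∑-1 xs)

  ∑-nonneg : {X : Set} (xs : List X) {f : X → ℤ} → (∀ x → 0ℤ ℤ.≤ f x) → 0ℤ ℤ.≤ ∑ xs f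
  ∑-nonneg []       0≤f = +≤+ ℕ.z≤n
  ∑-nonneg (x ∷ xs) 0≤f = ℤₚ.+-mono-≤ (0≤f x) (∑-nonneg xs 0≤f)

  ∑-nonneg-zero : {X : Set} {xs : List X} {f : X → ℤ} → (∀ x → 0ℤ ℤ.≤ f x) → ∑ xs f ≡ 0ℤ → ∀ {x} → x ∈ xs → f x ≡ 0ℤ
  ∑-nonneg-zero {xs = y ∷ xs} {f} 0≤f e x∈ = go x∈
    where
    head≡0 : f y ≡ 0ℤ
    head≡0 = ℤₚ.≤-antisym
      (subst₂ ℤ._≤_ (ℤₚ.+-identityʳ (f y)) e (ℤₚ.+-monoʳ-≤ (f y) (∑-nonneg xs 0≤f))) (0≤f y)
    go : ∀ {x} → x ∈ (y ∷ xs) → f x ≡ 0ℤ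
    go (here refl) = head≡0
    go (there x∈)  = ∑-nonneg-zero 0≤f (trans (sym (ℤₚ.+-identityˡ _)) (trans (cong (_+ ∑ xs f) (sym head≡0)) e)) x∈

  ∈-elements : ∀ x → x ∈ elements
  ∈-elements x = subst (_∈ elements) (to∘from x) (∈-map⁺ to (∈-allFin (from x)))

  ΣF-1 : ΣF (λ _ → 1ℤ) ≡ + q
  ΣF-1 = trans (∑-1 elements) (cong +_ (length-elements F))

  -- The principal character, extended by 0.
  ν : C → ℤ
  ν x = ind (not (x == 0ᶠ))

  ν≡1-δ : ∀ x → ν x ≡ 1ℤ - δ x 0ᶠ
  ν≡1-δ x with x == 0ᶠ
  ... | true  = refl
  ... | false = refl

  ΣF-ν : ∀ f → ΣF (λ x → ν x * f x) ≡ ΣF f - f 0ᶠ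
  ΣF-ν f = begin
    ΣF (λ x → ν x * f x)             ≡⟨ ∑-cong elements (λ x → trans (cong (_* f x) (ν≡1-δ x)) (rearrange (δ x 0ᶠ) (f x))) ⟩
    ΣF (λ x → f x - δ x 0ᶠ * f x)    ≡⟨ ∑-sub elements f _ ⟩
    ΣF f - ΣF (λ x → δ x 0ᶠ * f x)   ≡⟨ cong (λ z → ΣF f - z) (ΣF-δ 0ᶠ f) ⟩
    ΣF f - f 0ᶠ                      ∎
    where
    rearrange : ∀ d y → (1ℤ - d) * y ≡ y - d * y
    rearrange = solve-∀

  ΣF-reflect : ∀ c f → ΣF (λ a → f (c -ᶠ a)) ≡ ΣF f
  ΣF-reflect c = ΣF-bijection (λ a → c -ᶠ a) (λ a → c -ᶠ a) (c-[c-x] c) (c-[c-x] c)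

  ΣF-shift : ∀ c f → ΣF (λ a → f (a -ᶠ c)) ≡ ΣF f
  ΣF-shift c = ΣF-bijection (_-ᶠ c) (_+ᶠ c) (x-c+c c) (x+c-c c)

  ΣF-scale : ∀ {m} → ¬ m ≡ 0ᶠ → ∀ f → ΣF (λ a → f (m *ᶠ a)) ≡ ΣF f
  ΣF-scale {m} m≢0 with inverse m m≢0
  ... | n , mn≡1 = ΣF-bijection (m *ᶠ_) (n *ᶠ_) (*ᶠ-cancel mn≡1) (*ᶠ-cancel (trans (*ᶠ-comm n m) mn≡1))

-- The quadratic character.

module QuadraticCharacter {q : ℕ} (F : FiniteField q) (2≢0 : ¬ FiniteField.ι F 2 ≡ FiniteField.0# F) where
  open FieldProperties F
  open FiniteField F using (ι; χ; isSquare)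
  open IntegerSums F
  open ≡-Reasoning

  isSquare-true : ∀ {a} → isSquare a ≡ true → ∃ λ y → y *ᶠ y ≡ a
  isSquare-true {a} e with Any.satisfied (any⁻ (λ y → (y *ᶠ y) == a) elements (Equivalence.from T-≡ e))
  ... | y , Ty = y , ==⇒≡ (Equivalence.to T-≡ Ty)

  isSquare-false : ∀ {a} → isSquare a ≡ false → ∀ y → ¬ y *ᶠ y ≡ a
  isSquare-false {a} e y yy≡a = contradiction (trans (sym e) (Equivalence.to T-≡
    (any⁺ (λ y → (y *ᶠ y) == a) (lose (∈-elements y) (Equivalence.from T-≡ (==-true yy≡a)))))) λ ()

  -- Each case pairs the value of `χ` with its algebraic reason, so that later case distinctions
  -- need not unfold the Boolean search in `isSquare`.
  data χ-View (a : C) : Set where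
    zero      : a ≡ 0ᶠ → χ a ≡ 0ℤ → χ-View a
    square    : ∀ y → ¬ y ≡ 0ᶠ → a ≡ y *ᶠ y → χ a ≡ 1ℤ → χ-View a
    nonsquare : ¬ a ≡ 0ᶠ → (∀ y → ¬ y *ᶠ y ≡ a) → χ a ≡ -1ℤ → χ-View a

  χ-view : ∀ a → χ-View a
  χ-view a with a ≟ 0ᶠ
  ... | yes a≡0 = zero a≡0 χ≡
    where
    χ≡ : χ a ≡ 0ℤ
    χ≡ rewrite ==-true a≡0 = refl
  ... | no a≢0 with isSquare a in e
  ...   | true  = square (proj₁ root) (λ y≡0 → a≢0 (trans (sym (proj₂ root)) (trans (cong₂ _*ᶠ_ y≡0 y≡0) (zeroᶠˡ 0ᶠ))))
                    (sym (proj₂ root)) χ≡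
    where
    root = isSquare-true e
    χ≡ : χ a ≡ 1ℤ
    χ≡ rewrite ==-false a≢0 | e = refl
  ...   | false = nonsquare a≢0 (isSquare-false e) χ≡
    where
    χ≡ : χ a ≡ -1ℤ
    χ≡ rewrite ==-false a≢0 | e = refl

  χ-0 : χ 0ᶠ ≡ 0ℤ
  χ-0 with χ-view 0ᶠ
  ... | zero _ e           = e
  ... | square y y≢0 e _   = contradiction (x²≡0⇒x≡0 (sym e)) y≢0
  ... | nonsquare 0≢0 _ _  = contradiction refl 0≢0

  -- This is where odd characteristic enters: the two roots of a nonzero square are distinct.
  y≢-y : ∀ {y} → ¬ y ≡ 0ᶠ → ¬ y ≡ -ᶠ y
  y≢-y {y} y≢0 e = *ᶠ-≢0 2≢0 y≢0 (begin
    (1ᶠ +ᶠ (1ᶠ +ᶠ 0ᶠ)) *ᶠ y ≡⟨ cong (λ z → (1ᶠ +ᶠ z) *ᶠ y) (+ᶠ-identityʳ 1ᶠ) ⟩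
    (1ᶠ +ᶠ 1ᶠ) *ᶠ y         ≡⟨ distribᶠʳ y 1ᶠ 1ᶠ ⟩
    1ᶠ *ᶠ y +ᶠ 1ᶠ *ᶠ y      ≡⟨ cong₂ _+ᶠ_ (trans (*ᶠ-identityˡ y) e) (*ᶠ-identityˡ y) ⟩
    (-ᶠ y) +ᶠ y             ≡⟨ -ᶠ-inverseˡ y ⟩
    0ᶠ                      ∎)

  roots : C → ℤ
  roots a = ΣF (λ x → δ a (x *ᶠ x))

  -- The vanishing sum of `χ` and its multiplicativity are both drawn from this count of square
  -- roots; no generator of the multiplicative group is chosen.
  roots≡1+χ : ∀ a → roots a ≡ 1ℤ + χ a
  roots≡1+χ a with χ-view a
  ... | zero refl e = trans
    (∑-cong elements (λ x → cong ind (==-cong⇔ (λ 0≡xx → x²≡0⇒x≡0 (sym 0≡xx)) (λ x≡0 → sym (trans (cong₂ _*ᶠ_ x≡0 x≡0) (zeroᶠˡ 0ᶠ))))))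
    (trans (ΣF-δ₁ 0ᶠ) (sym (cong (λ z → 1ℤ + z) e)))
  ... | square y y≢0 refl e = trans (∑-cong elements two) (trans (∑-+ elements _ _)
    (trans (cong₂ _+_ (ΣF-δ₁ y) (ΣF-δ₁ (-ᶠ y))) (sym (cong (λ z → 1ℤ + z) e))))
    where
    two : ∀ x → δ (y *ᶠ y) (x *ᶠ x) ≡ δ x y + δ x (-ᶠ y)
    two x with x ≟ y | x ≟ (-ᶠ y)
    ... | yes x≡y | yes x≡-y = contradiction (trans (sym x≡y) x≡-y) (y≢-y y≢0)
    ... | yes x≡y | no x≢-y  = trans (δ-≡ (sym (cong₂ _*ᶠ_ x≡y x≡y))) (sym (cong₂ _+_ (δ-≡ x≡y) (δ-≢ x≢-y)))
    ... | no x≢y  | yes x≡-y = trans (δ-≡ (sym (trans (cong₂ _*ᶠ_ x≡-y x≡-y) (-ᶠ-square y)))) (sym (cong₂ _+_ (δ-≢ x≢y) (δ-≡ x≡-y)))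
    ... | no x≢y  | no x≢-y  = trans (δ-≢ neither) (sym (cong₂ _+_ (δ-≢ x≢y) (δ-≢ x≢-y)))
      where
      neither : ¬ y *ᶠ y ≡ x *ᶠ x
      neither e with x²≡y²⇒x≡±y (sym e)
      ... | inj₁ x≡y  = x≢y x≡y
      ... | inj₂ x≡-y = x≢-y x≡-y
  ... | nonsquare _ none e = trans (∑-cong elements (λ x → δ-≢ (none x ∘ sym))) (trans (∑-zero elements) (sym (cong (λ z → 1ℤ + z) e)))

  -- Every `x` is a root of exactly one `a`, so the numbers `1 + χ a` add up to `q`, and so do the
  -- ones alone.
  ΣF-χ : ΣF χ ≡ 0ℤ
  ΣF-χ = +-cancelˡ (+ q) _ _ (begin
    + q + ΣF χ                      ≡⟨ cong (_+ ΣF χ) (sym ΣF-1) ⟩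
    ΣF (λ _ → 1ℤ) + ΣF χ            ≡⟨ sym (∑-+ elements _ χ) ⟩
    ΣF (λ a → 1ℤ + χ a)             ≡⟨ ∑-cong elements (λ a → trans (sym (roots≡1+χ a)) (sym (ℤₚ.*-identityʳ _))) ⟩
    ΣF (λ a → roots a * 1ℤ)         ≡⟨ sym (ΣF-fibre (λ x → x *ᶠ x) (λ _ → 1ℤ)) ⟩
    ΣF (λ _ → 1ℤ)                   ≡⟨ ΣF-1 ⟩
    + q                             ≡⟨ sym (ℤₚ.+-identityʳ (+ q)) ⟩
    + q + 0ℤ                        ∎)

  -- Multiplication by `y` carries the square roots of `a` to those of `y² a`, so both have equally
  -- many.
  χ-square* : ∀ {y} → ¬ y ≡ 0ᶠ → ∀ a → χ ((y *ᶠ y) *ᶠ a) ≡ χ a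
  χ-square* {y} y≢0 a = +-cancelˡ 1ℤ _ _ (begin
    1ℤ + χ ((y *ᶠ y) *ᶠ a)                                   ≡⟨ sym (roots≡1+χ _) ⟩
    ΣF (λ x → δ ((y *ᶠ y) *ᶠ a) (x *ᶠ x))                    ≡⟨ sym (ΣF-scale y≢0 _) ⟩
    ΣF (λ x → δ ((y *ᶠ y) *ᶠ a) ((y *ᶠ x) *ᶠ (y *ᶠ x)))      ≡⟨ ∑-cong elements (λ x → cong ind (==-cong⇔ (to-a x) (from-a x))) ⟩
    roots a                                                  ≡⟨ roots≡1+χ a ⟩
    1ℤ + χ a                                                 ∎)
    where
    yy≢0 = *ᶠ-≢0 y≢0 y≢0
    n = proj₁ (inverse (y *ᶠ y) yy≢0)
    cancel = *ᶠ-cancel (proj₂ (inverse (y *ᶠ y) yy≢0))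
    to-a : ∀ x → (y *ᶠ y) *ᶠ a ≡ (y *ᶠ x) *ᶠ (y *ᶠ x) → a ≡ x *ᶠ x
    to-a x e = trans (sym (cancel a)) (trans (cong (n *ᶠ_) (trans e (*ᶠ-square y x))) (cancel _))
    from-a : ∀ x → a ≡ x *ᶠ x → (y *ᶠ y) *ᶠ a ≡ (y *ᶠ x) *ᶠ (y *ᶠ x)
    from-a x e = trans (cong ((y *ᶠ y) *ᶠ_) e) (sym (*ᶠ-square y x))

  -- −(χ(na) + χ(a)) is never negative and sums to zero over a, hence vanishes.
  χ-nonsquare* : ∀ {n} → ¬ n ≡ 0ᶠ → χ n ≡ -1ℤ → ∀ a → χ (n *ᶠ a) ≡ - χ a
  χ-nonsquare* {n} n≢0 χn≡-1 a =
    isolate (∑-nonneg-zero {f = λ a → - (χ (n *ᶠ a) + χ a)} nonneg total (∈-elements a))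
    where
    isolate : ∀ {x y} → - (x + y) ≡ 0ℤ → x ≡ - y
    isolate {x} {y} e = trans (rearrange x y) (trans (cong (λ z → - z - y) e) (ℤₚ.+-identityˡ (- y)))
      where
      rearrange : ∀ x y → x ≡ - (- (x + y)) - y
      rearrange = solve-∀
    0≤-sum : ∀ {u v} {x y : ℤ} → x ≡ u → y ≡ v → 0ℤ ℤ.≤ - (u + v) → 0ℤ ℤ.≤ - (x + y)
    0≤-sum x≡u y≡v = subst₂ (λ u v → 0ℤ ℤ.≤ - (u + v)) (sym x≡u) (sym y≡v)
    nonneg : ∀ a → 0ℤ ℤ.≤ - (χ (n *ᶠ a) + χ a)
    nonneg a with χ-view a
    ... | zero refl e         = 0≤-sum (trans (cong χ (zeroᶠʳ n)) e) e (+≤+ ℕ.z≤n)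
    ... | square y y≢0 refl e = 0≤-sum (trans (cong χ (*ᶠ-comm n (y *ᶠ y))) (trans (χ-square* y≢0 n) χn≡-1)) e (+≤+ ℕ.z≤n)
    ... | nonsquare _ _ e with χ-view (n *ᶠ a)
    ...   | zero _ e′          = 0≤-sum e′ e (+≤+ ℕ.z≤n)
    ...   | square _ _ _ e′    = 0≤-sum e′ e (+≤+ ℕ.z≤n)
    ...   | nonsquare _ _ e′   = 0≤-sum e′ e (+≤+ ℕ.z≤n)
    total : ΣF (λ a → - (χ (n *ᶠ a) + χ a)) ≡ 0ℤ
    total = begin
      ΣF (λ a → - (χ (n *ᶠ a) + χ a))      ≡⟨ ∑-neg elements _ ⟩
      - ΣF (λ a → χ (n *ᶠ a) + χ a)        ≡⟨ cong -_ (∑-+ elements _ χ) ⟩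
      - (ΣF (λ a → χ (n *ᶠ a)) + ΣF χ)     ≡⟨ cong -_ (cong₂ _+_ (trans (ΣF-scale n≢0 χ) ΣF-χ) ΣF-χ) ⟩
      0ℤ                                   ∎

  χ-* : ∀ m a → χ (m *ᶠ a) ≡ χ m * χ a
  χ-* m a with χ-view m
  ... | zero refl e         = trans (cong χ (zeroᶠˡ a)) (trans χ-0 (sym (cong (_* χ a) e)))
  ... | square y y≢0 refl e = trans (χ-square* y≢0 a) (sym (trans (cong (_* χ a) e) (ℤₚ.*-identityˡ (χ a))))
  ... | nonsquare m≢0 _ e   = trans (χ-nonsquare* m≢0 e a) (sym (trans (cong (_* χ a) e) (ℤₚ.-1*i≡-i (χ a))))

  χ² : ∀ a → χ a * χ a ≡ ν a
  χ² a with χ-view a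
  ... | zero a≡0 e          = trans (cong₂ _*_ e e) (sym (trans (ν≡1-δ a) (cong (λ z → 1ℤ - z) (δ-≡ a≡0))))
  ... | square y y≢0 a≡ e   = trans (cong₂ _*_ e e)
    (sym (trans (ν≡1-δ a) (cong (λ z → 1ℤ - z) (δ-≢ (λ a≡0 → y≢0 (x²≡0⇒x≡0 (trans (sym a≡) a≡0)))))))
  ... | nonsquare a≢0 _ e   = trans (cong₂ _*_ e e) (sym (trans (ν≡1-δ a) (cong (λ z → 1ℤ - z) (δ-≢ a≢0))))

  ν-≢ : ∀ {a} → ¬ a ≡ 0ᶠ → ν a ≡ 1ℤ
  ν-≢ {a} a≢0 = trans (ν≡1-δ a) (cong (λ z → 1ℤ - z) (δ-≢ a≢0))

  ΣF-ν₁ : ΣF ν ≡ + q - 1ℤ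
  ΣF-ν₁ = trans (∑-cong elements (λ x → sym (ℤₚ.*-identityʳ (ν x)))) (trans (ΣF-ν (λ _ → 1ℤ)) (cong (_- 1ℤ) ΣF-1))

  χ-1 : χ 1ᶠ ≡ 1ℤ
  χ-1 with χ-view 1ᶠ
  ... | zero 1≡0 _        = contradiction (sym 1≡0) 0≢1
  ... | square _ _ _ e    = e
  ... | nonsquare _ none _ = contradiction (*ᶠ-identityˡ 1ᶠ) (none 1ᶠ)

  -- Jacobi sums of the quadratic character.

  ε : ℤ
  ε = χ (-ᶠ 1ᶠ)

  χ-neg : ∀ a → χ (-ᶠ a) ≡ ε * χ a
  χ-neg a = trans (cong χ (sym (-1*ᶠ a))) (χ-* (-ᶠ 1ᶠ) a)

  -- The convolution of `χ` with itself, that is, the coefficient of [c] in Q². At `c = 1` it is the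
  -- classical Jacobi sum.
  J : C → ℤ
  J c = ΣF (λ a → χ a * χ (c -ᶠ a))

  J-0 : J 0ᶠ ≡ ε * (+ q - 1ℤ)
  J-0 = begin
    ΣF (λ a → χ a * χ (0ᶠ -ᶠ a)) ≡⟨ ∑-cong elements (λ a → trans (cong (χ a *_) (trans (cong χ (+ᶠ-identityˡ _)) (χ-neg a)))
                                       (trans (rearrange (χ a) ε) (cong (ε *_) (χ² a)))) ⟩
    ΣF (λ a → ε * ν a)           ≡⟨ ∑-*ˡ elements ε ν ⟩
    ε * ΣF ν                     ≡⟨ cong (ε *_) ΣF-ν₁ ⟩
    ε * (+ q - 1ℤ)               ∎
    where
    rearrange : ∀ x e → x * (e * x) ≡ e * (x * x)
    rearrange = solve-∀

  -- Substituting `m a` for `a` pulls out `χ m` twice, and `χ m * χ m` is 1.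
  J-scale : ∀ {m} → ¬ m ≡ 0ᶠ → J m ≡ J 1ᶠ
  J-scale {m} m≢0 = begin
    ΣF (λ a → χ a * χ (m -ᶠ a))                   ≡⟨ sym (ΣF-scale m≢0 _) ⟩
    ΣF (λ a → χ (m *ᶠ a) * χ (m -ᶠ m *ᶠ a))       ≡⟨ ∑-cong elements pointwise ⟩
    J 1ᶠ                                          ∎
    where
    rearrange : ∀ m x y → (m * x) * (m * y) ≡ (m * m) * (x * y)
    rearrange = solve-∀
    pointwise : ∀ a → χ (m *ᶠ a) * χ (m -ᶠ m *ᶠ a) ≡ χ a * χ (1ᶠ -ᶠ a)
    pointwise a = begin
      χ (m *ᶠ a) * χ (m -ᶠ m *ᶠ a)         ≡⟨ cong (λ z → χ (m *ᶠ a) * χ (z -ᶠ m *ᶠ a)) (sym (*ᶠ-identityʳ m)) ⟩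
      χ (m *ᶠ a) * χ (m *ᶠ 1ᶠ -ᶠ m *ᶠ a)   ≡⟨ cong (λ z → χ (m *ᶠ a) * χ z) (sym (*ᶠ-distrib-- m 1ᶠ a)) ⟩
      χ (m *ᶠ a) * χ (m *ᶠ (1ᶠ -ᶠ a))      ≡⟨ cong₂ _*_ (χ-* m a) (χ-* m (1ᶠ -ᶠ a)) ⟩
      (χ m * χ a) * (χ m * χ (1ᶠ -ᶠ a))    ≡⟨ rearrange (χ m) (χ a) _ ⟩
      (χ m * χ m) * (χ a * χ (1ᶠ -ᶠ a))    ≡⟨ cong (_* (χ a * χ (1ᶠ -ᶠ a))) (trans (χ² m) (ν-≢ m≢0)) ⟩
      1ℤ * (χ a * χ (1ᶠ -ᶠ a))             ≡⟨ ℤₚ.*-identityˡ _ ⟩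
      χ a * χ (1ᶠ -ᶠ a)                    ∎

  -- The total of a convolution is the product of the totals, here the square of `ΣF χ`.
  ΣF-J : ΣF J ≡ 0ℤ
  ΣF-J = begin
    ΣF (λ c → ΣF (λ a → χ a * χ (c -ᶠ a)))  ≡⟨ ∑-swap elements elements _ ⟩
    ΣF (λ a → ΣF (λ c → χ a * χ (c -ᶠ a)))  ≡⟨ ∑-cong elements (λ a → trans (∑-*ˡ elements (χ a) _)
                                                (trans (cong (χ a *_) (trans (ΣF-shift a χ) ΣF-χ)) (ℤₚ.*-zeroʳ (χ a)))) ⟩
    ΣF (λ a → 0ℤ)                           ≡⟨ ∑-zero elements ⟩
    0ℤ                                      ∎

  J-ν : ∀ c → J c ≡ δ c 0ᶠ * J 0ᶠ + ν c * J 1ᶠ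
  J-ν c with c ≟ 0ᶠ
  ... | yes refl rewrite ==-true {0ᶠ} refl = sym (trans (ℤₚ.+-identityʳ _) (ℤₚ.*-identityˡ _))
  ... | no c≢0  = trans (J-scale c≢0) (sym (trans (cong₂ (λ d n → d * J 0ᶠ + n * J 1ᶠ) (δ-≢ c≢0) (ν-≢ c≢0))
                    (trans (ℤₚ.+-identityˡ _) (ℤₚ.*-identityˡ _))))

  -- By `J-scale` the total of `J` is `J 0 + (q - 1) J 1`. It vanishes and `J 0 = ε (q - 1)`, so
  -- cancelling `q - 1` leaves the value without evaluating any single summand.
  J-1 : J 1ᶠ ≡ - ε
  J-1 = ℤₚ.*-cancelʳ-≡ (J 1ᶠ) (- ε) (+ q - 1ℤ) {{≢-nonZero q-1≢0}} (begin
    J 1ᶠ * (+ q - 1ℤ)                        ≡⟨ rearrange (J 1ᶠ) (+ q - 1ℤ) ε ⟩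
    (ε * Q + Q * J 1ᶠ) + (- ε) * Q           ≡⟨ cong (_+ (- ε) * Q) sum≡0 ⟩
    0ℤ + (- ε) * Q                           ≡⟨ ℤₚ.+-identityˡ _ ⟩
    (- ε) * Q                                ∎)
    where
    Q = + q - 1ℤ
    q-1≢0 : ¬ + q - 1ℤ ≡ 0ℤ
    q-1≢0 e = q≢1 F (ℤₚ.+-injective (ℤₚ.i-j≡0⇒i≡j (+ q) 1ℤ e))
    rearrange : ∀ j x e → j * x ≡ (e * x + x * j) + (- e) * x
    rearrange = solve-∀
    sum≡0 : ε * Q + Q * J 1ᶠ ≡ 0ℤ
    sum≡0 = begin
      ε * Q + Q * J 1ᶠ                                      ≡⟨ cong₂ _+_ (sym J-0) (cong (_* J 1ᶠ) (sym ΣF-ν₁)) ⟩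
      J 0ᶠ + ΣF ν * J 1ᶠ                                    ≡⟨ cong₂ _+_ (sym (ΣF-δ 0ᶠ (λ _ → J 0ᶠ))) (sym (∑-*ʳ elements (J 1ᶠ) ν)) ⟩
      ΣF (λ c → δ c 0ᶠ * J 0ᶠ) + ΣF (λ c → ν c * J 1ᶠ)      ≡⟨ sym (∑-+ elements _ _) ⟩
      ΣF (λ c → δ c 0ᶠ * J 0ᶠ + ν c * J 1ᶠ)                 ≡⟨ ∑-cong elements (λ c → sym (J-ν c)) ⟩
      ΣF J                                                  ≡⟨ ΣF-J ⟩
      0ℤ                                                    ∎

  -- The coefficient form of Q² = ε (q 1 - T).
  J-value : ∀ c → J c ≡ ε * (+ q * δ c 0ᶠ - 1ℤ)
  J-value c = trans (J-ν c) (trans (cong₂ (λ x y → δ c 0ᶠ * x + ν c * y) J-0 J-1)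
                (trans (cong (λ n → δ c 0ᶠ * (ε * (+ q - 1ℤ)) + n * - ε) (ν≡1-δ c)) (rearrange (δ c 0ᶠ) ε (+ q))))
    where
    rearrange : ∀ d e q → d * (e * (q - 1ℤ)) + (1ℤ - d) * - e ≡ e * (q * d - 1ℤ)
    rearrange = solve-∀

  ε≡±1 : ε ≡ 1ℤ ⊎ ε ≡ -1ℤ
  ε≡±1 with χ-view (-ᶠ 1ᶠ)
  ... | zero -1≡0 _     = contradiction (sym (trans (sym (-ᶠ-involutive 1ᶠ)) (trans (cong -ᶠ_ -1≡0) (trans (sym (+ᶠ-identityˡ _)) (-ᶠ-inverseʳ 0ᶠ))))) 0≢1
  ... | square _ _ _ e  = inj₁ e
  ... | nonsquare _ _ e = inj₂ e

  -- (1 + χ(z)) χ(1 - z) ≡ (1 + χ(z)) (1 - [z = 1]) modulo 4, pointwise; sum this over z.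
  -ε≡q-2[mod4] : ∃ λ M → - ε ≡ + q - + 2 + + 4 * M
  -ε≡q-2[mod4] = ΣF (λ z → proj₁ (pointwise z)) , (begin
    - ε                                                   ≡⟨ sym J-1 ⟩
    J 1ᶠ                                                  ≡⟨ sym (ℤₚ.+-identityˡ _) ⟩
    0ℤ + J 1ᶠ                                             ≡⟨ cong (_+ J 1ᶠ) (sym (trans (ΣF-reflect 1ᶠ χ) ΣF-χ)) ⟩
    ΣF (λ z → χ (1ᶠ -ᶠ z)) + J 1ᶠ                         ≡⟨ sym (∑-+ elements _ _) ⟩
    ΣF (λ z → χ (1ᶠ -ᶠ z) + χ z * χ (1ᶠ -ᶠ z))            ≡⟨ ∑-cong elements (λ z → trans (factor (χ z) _) (proj₂ (pointwise z))) ⟩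
    ΣF (λ z → (1ℤ + χ z) * (1ℤ - δ z 1ᶠ) + + 4 * m z)     ≡⟨ ∑-cong elements (λ z → expand (χ z) (δ z 1ᶠ) (+ 4 * m z)) ⟩
    ΣF (λ z → ((1ℤ + χ z) - δ z 1ᶠ * (1ℤ + χ z)) + + 4 * m z) ≡⟨ ∑-+ elements _ _ ⟩
    ΣF (λ z → (1ℤ + χ z) - δ z 1ᶠ * (1ℤ + χ z)) + ΣF (λ z → + 4 * m z)
      ≡⟨ cong₂ _+_ (∑-sub elements _ _) (∑-*ˡ elements (+ 4) m) ⟩
    (ΣF (λ z → 1ℤ + χ z) - ΣF (λ z → δ z 1ᶠ * (1ℤ + χ z))) + + 4 * ΣF m
      ≡⟨ cong (_+ + 4 * ΣF m) (cong₂ (λ x y → x - y) (trans (∑-+ elements _ χ) (trans (cong₂ _+_ ΣF-1 ΣF-χ) (ℤₚ.+-identityʳ (+ q))))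
                                          (trans (ΣF-δ 1ᶠ _) (cong (λ z → 1ℤ + z) χ-1))) ⟩
    + q - + 2 + + 4 * ΣF m                                ∎)
    where
    factor : ∀ x y → y + x * y ≡ (1ℤ + x) * y
    factor = solve-∀
    expand : ∀ x d w → (1ℤ + x) * (1ℤ - d) + w ≡ ((1ℤ + x) - d * (1ℤ + x)) + w
    expand = solve-∀
    given : ∀ {x x′ y y′ d d′ : ℤ} (m : ℤ) → x ≡ x′ → y ≡ y′ → d ≡ d′ →
            (1ℤ + x′) * y′ ≡ (1ℤ + x′) * (1ℤ - d′) + + 4 * m → ∃ λ m → (1ℤ + x) * y ≡ (1ℤ + x) * (1ℤ - d) + + 4 * m
    given m refl refl refl e = m , e
    1-z≢0 : ∀ {z} → ¬ 1ᶠ -ᶠ z ≡ 0ᶠ → ¬ z ≡ 1ᶠ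
    1-z≢0 1-z≢0 refl = 1-z≢0 (-ᶠ-inverseʳ 1ᶠ)
    pointwise : ∀ z → ∃ λ m → (1ℤ + χ z) * χ (1ᶠ -ᶠ z) ≡ (1ℤ + χ z) * (1ℤ - δ z 1ᶠ) + + 4 * m
    pointwise z with χ-view z
    ... | zero refl e = given 0ℤ e (trans (cong χ (c-0 1ᶠ)) χ-1) (δ-≢ 0≢1) refl
    ... | nonsquare _ _ e = 0ℤ , trans (cong (λ x → (1ℤ + x) * χ (1ᶠ -ᶠ z)) e) (sym (cong (λ x → (1ℤ + x) * (1ℤ - δ z 1ᶠ) + 0ℤ) e))
    -- Here `1 + χ z` is 2, so `χ (1 - z)` matters only modulo 2, where it is 1 unless `z = 1`. The
    -- value -1 in place of 1 costs 4, hence the witness -1 in the last case.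
    ... | square _ _ _ e with χ-view (1ᶠ -ᶠ z)
    ...   | zero 1-z≡0 e′       = given 0ℤ e e′ (δ-≡ (sym (x-y≡0⇒x≡y 1-z≡0))) refl
    ...   | square y y≢0 e″ e′  = given 0ℤ e e′ (δ-≢ (1-z≢0 (λ z≡0 → y≢0 (x²≡0⇒x≡0 (trans (sym e″) z≡0))))) refl
    ...   | nonsquare 1-z≢0′ _ e′ = given -1ℤ e e′ (δ-≢ (1-z≢0 1-z≢0′)) refl
    m = λ z → proj₁ (pointwise z)

  χ-inverse : ∀ {i j} → i *ᶠ j ≡ 1ᶠ → χ j ≡ χ i
  χ-inverse {i} {j} ij≡1 = begin
    χ j                       ≡⟨ sym (ℤₚ.*-identityˡ _) ⟩
    1ℤ * χ j                  ≡⟨ cong (_* χ j) (sym χiχj≡1) ⟩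
    (χ i * χ j) * χ j         ≡⟨ ℤₚ.*-assoc (χ i) (χ j) (χ j) ⟩
    χ i * (χ j * χ j)         ≡⟨ cong (χ i *_) (trans (χ² j) (ν-≢ j≢0)) ⟩
    χ i * 1ℤ                  ≡⟨ ℤₚ.*-identityʳ _ ⟩
    χ i                       ∎
    where
    χiχj≡1 = trans (sym (χ-* i j)) (trans (cong χ ij≡1) χ-1)
    j≢0 : ¬ j ≡ 0ᶠ
    j≢0 refl = 0≢1 (trans (sym (zeroᶠʳ i)) ij≡1)

  -- Division by `i` reduces this to `roots≡1+χ`, since `i` and its inverse have the same character.
  -- These are the coefficients of T + χ(i) Q.
  twisted-roots : ∀ {i} → ¬ i ≡ 0ᶠ → ∀ a → ΣF (λ x → δ a (i *ᶠ (x *ᶠ x))) ≡ 1ℤ + χ i * χ a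
  twisted-roots {i} i≢0 a with inverse i i≢0
  ... | j , ij≡1 = begin
    ΣF (λ x → δ a (i *ᶠ (x *ᶠ x)))   ≡⟨ ∑-cong elements (λ x → cong ind (==-cong⇔
                                          (λ e → trans (cong (j *ᶠ_) e) (*ᶠ-cancel ij≡1 _))
                                          (λ e → trans (sym (*ᶠ-cancel (trans (*ᶠ-comm j i) ij≡1) a)) (cong (i *ᶠ_) e)))) ⟩
    roots (j *ᶠ a)                   ≡⟨ roots≡1+χ _ ⟩
    1ℤ + χ (j *ᶠ a)                  ≡⟨ cong (λ z → 1ℤ + z) (trans (χ-* j a) (cong (_* χ a) (χ-inverse ij≡1))) ⟩
    1ℤ + χ i * χ a                   ∎

  module _ {i : C} (i≢0 : ¬ i ≡ 0ᶠ) (c : C) where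

    -- The convolution of `f` with T - 1 + χ(i) Q, term by term; `ΣF-ν` supplies the subtracted
    -- `f c`, the contribution of `x = 0`.
    squareShift : (f : C → ℤ) → ΣF (λ x → ν x * f (c -ᶠ i *ᶠ (x *ᶠ x))) ≡ (ΣF f + χ i * ΣF (λ a → χ a * f (c -ᶠ a))) - f c
    squareShift f = begin
      ΣF (λ x → ν x * f (c -ᶠ i *ᶠ (x *ᶠ x)))                              ≡⟨ ΣF-ν _ ⟩
      ΣF (λ x → f (c -ᶠ i *ᶠ (x *ᶠ x))) - f (c -ᶠ i *ᶠ (0ᶠ *ᶠ 0ᶠ))
        ≡⟨ cong₂ _-_ (ΣF-fibre (λ x → i *ᶠ (x *ᶠ x)) (λ a → f (c -ᶠ a)))
             (cong f (trans (cong (λ z → c -ᶠ z) (trans (cong (i *ᶠ_) (zeroᶠˡ 0ᶠ)) (zeroᶠʳ i))) (c-0 c))) ⟩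
      ΣF (λ a → ΣF (λ x → δ a (i *ᶠ (x *ᶠ x))) * f (c -ᶠ a)) - f c
        ≡⟨ cong (_- f c) (∑-cong elements (λ a → trans (cong (_* f (c -ᶠ a)) (twisted-roots i≢0 a)) (expand (χ i) (χ a) (f (c -ᶠ a))))) ⟩
      ΣF (λ a → f (c -ᶠ a) + χ i * (χ a * f (c -ᶠ a))) - f c
        ≡⟨ cong (_- f c) (trans (∑-+ elements _ _) (cong₂ _+_ (ΣF-reflect c f) (∑-*ˡ elements (χ i) _))) ⟩
      (ΣF f + χ i * ΣF (λ a → χ a * f (c -ᶠ a))) - f c                     ∎
      where
      expand : ∀ x y z → (1ℤ + x * y) * z ≡ z + x * (y * z)
      expand = solve-∀

    squareShift-δ : ΣF (λ x → ν x * δ (c -ᶠ i *ᶠ (x *ᶠ x)) 0ᶠ) ≡ (1ℤ + χ i * χ c) - δ c 0ᶠ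
    squareShift-δ = trans (squareShift (λ a → δ a 0ᶠ)) (cong (_- δ c 0ᶠ) (cong₂ (λ x y → x + χ i * y) (ΣF-δ₁ 0ᶠ) (begin
      ΣF (λ a → χ a * δ (c -ᶠ a) 0ᶠ)   ≡⟨ ∑-cong elements (λ a → trans (ℤₚ.*-comm (χ a) _) (cong (λ d → ind d * χ a)
                                          (==-cong⇔ (λ e → sym (x-y≡0⇒x≡y e)) (λ e → trans (cong (λ z → c -ᶠ z) e) (-ᶠ-inverseʳ c))))) ⟩
      ΣF (λ a → δ a c * χ a)           ≡⟨ ΣF-δ c χ ⟩
      χ c                              ∎)))

    -- Here T Q = 0 removes the first term of `squareShift`, and `J-value` evaluates Q² in the
    -- second.
    squareShift-χ : ΣF (λ x → ν x * χ (c -ᶠ i *ᶠ (x *ᶠ x))) ≡ χ i * (ε * (+ q * δ c 0ᶠ - 1ℤ)) - χ c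
    squareShift-χ = trans (squareShift χ) (cong (_- χ c) (trans (cong₂ (λ x y → x + χ i * y) ΣF-χ (J-value c)) (ℤₚ.+-identityˡ (χ i * (ε * (+ q * δ c 0ᶠ - 1ℤ))))))

-- Tuples of distinct elements and Newton's identities.

all-cong : {X : Set} (xs : List X) {f g : X → Bool} → (∀ x → f x ≡ g x) → all f xs ≡ all g xs
all-cong []       f≡g = refl
all-cong (x ∷ xs) f≡g = cong₂ _∧_ (f≡g x) (all-cong xs f≡g)

all-∧ : {X : Set} (xs : List X) (f g : X → Bool) → all (λ x → f x ∧ g x) xs ≡ all f xs ∧ all g xs
all-∧ []       f g = refl
all-∧ (x ∷ xs) f g with f x | g x
... | true  | true  = all-∧ xs f g
... | true  | false = sym (trans (∧-comm (all f xs) false) refl)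
... | false | _     = refl

all-tabulate : {X : Set} {n : ℕ} (h : Fin n → X) (f : X → Bool) → all f (tabulate h) ≡ all (f ∘ h) (allFin n)
all-tabulate {n = zero}  h f = refl
all-tabulate {n = suc n} h f =
  cong (f (h Fin.zero) ∧_) (trans (all-tabulate (h ∘ Fin.suc) f) (sym (all-tabulate Fin.suc (f ∘ h))))

module DistinctTuples {q : ℕ} (F : FiniteField q) where
  open FieldProperties F
  open FiniteField F using (ι; sumSq)
  open IntegerSums F
  open ≡-Reasoning

  _∖_ : (C → Bool) → C → (C → Bool)
  (P ∖ x) y = P y ∧ not (y == x)

  -- `P` holds the values still allowed. Choosing an entry removes it from `P`, which turns pairwise
  -- distinctness into a recursion on the length.
  tuples : ℕ → (C → Bool) → C → ℤ
  tuples zero    P c = δ c 0ᶠ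
  tuples (suc k) P c = ΣF (λ x → ind (P x) * tuples k (P ∖ x) (c -ᶠ x *ᶠ x))

  tuples-cong : ∀ k {P Q} → (∀ x → P x ≡ Q x) → ∀ c → tuples k P c ≡ tuples k Q c
  tuples-cong zero    P≡Q c = refl
  tuples-cong (suc k) P≡Q c = ∑-cong elements (λ x → cong₂ (λ a b → ind a * b) (P≡Q x)
    (tuples-cong k (λ y → cong (_∧ not (y == x)) (P≡Q y)) _))

  ∖-comm : ∀ P x y z → ((P ∖ x) ∖ y) z ≡ ((P ∖ y) ∖ x) z
  ∖-comm P x y z = trans (∧-assoc (P z) _ _) (trans (cong (P z ∧_) (∧-comm (not (z == x)) (not (z == y)))) (sym (∧-assoc (P z) _ _)))

  ind-∖ : ∀ P {x} → P x ≡ true → ∀ y → ind (P y) ≡ ind ((P ∖ x) y) + δ y x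
  ind-∖ P {x} Px y with y ≟ x
  ... | yes refl rewrite ==-true {y} refl | Px = refl
  ... | no y≢x rewrite ==-false y≢x with P y
  ...   | true  = refl
  ...   | false = refl

  -- Makes the condition `b ≡ true` available as a hypothesis under a sum weighted by `ind b`.
  ind-*-cong : ∀ b {u v : ℤ} → (b ≡ true → u ≡ v) → ind b * u ≡ ind b * v
  ind-*-cong true  f = cong (1ℤ *_) (f refl)
  ind-*-cong false f = refl

  -- A tuple of distinct elements that uses x has it in exactly one of k + 1 positions.
  tuples-∖ : ∀ k P {x} → P x ≡ true → ∀ c →
             tuples (suc k) P c ≡ tuples (suc k) (P ∖ x) c + + suc k * tuples k (P ∖ x) (c -ᶠ x *ᶠ x)
  tuples-∖ k P {x} Px c = begin
    ΣF (λ y → ind (P y) * g y)                                    ≡⟨ ∑-cong elements (λ y → trans (cong (_* g y) (ind-∖ P Px y)) (ℤₚ.*-distribʳ-+ (g y) (ind ((P ∖ x) y)) (δ y x))) ⟩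
    ΣF (λ y → ind ((P ∖ x) y) * g y + δ y x * g y)                ≡⟨ ∑-+ elements _ _ ⟩
    ΣF (λ y → ind ((P ∖ x) y) * g y) + ΣF (λ y → δ y x * g y)     ≡⟨ cong₂ _+_ (rest k refl) (ΣF-δ x g) ⟩
    (tuples (suc k) (P ∖ x) c + + k * t) + t                      ≡⟨ rearrange (tuples (suc k) (P ∖ x) c) (+ k) t ⟩
    tuples (suc k) (P ∖ x) c + + suc k * t                        ∎
    where
    g = λ y → tuples k (P ∖ y) (c -ᶠ y *ᶠ y)
    t = tuples k (P ∖ x) (c -ᶠ x *ᶠ x)
    rearrange : ∀ a k t → (a + k * t) + t ≡ a + (1ℤ + k) * t
    rearrange = solve-∀
    expand : ∀ i a k t → i * (a + k * t) ≡ i * a + k * (i * t)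
    expand = solve-∀
    ∖-true : ∀ y → (P ∖ x) y ≡ true → (P ∖ y) x ≡ true
    ∖-true y e with y ≟ x
    ... | yes y≡x rewrite ==-true y≡x = contradiction (trans (sym e) (∧-comm (P y) false)) λ ()
    ... | no y≢x rewrite ==-false (y≢x ∘ sym) = trans (∧-comm (P x) true) Px
    -- The summand `δ y x` has accounted for `x` in the first position. Here the first entry `y`
    -- differs from `x`, so the claim for the tail provides the `l` remaining positions.
    rest : ∀ l → l ≡ k → ΣF (λ y → ind ((P ∖ x) y) * tuples l (P ∖ y) (c -ᶠ y *ᶠ y))
                 ≡ tuples (suc l) (P ∖ x) c + + l * tuples l (P ∖ x) (c -ᶠ x *ᶠ x)
    rest zero    _ = sym (ℤₚ.+-identityʳ _)
    rest (suc l) refl = begin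
      ΣF (λ y → ind ((P ∖ x) y) * tuples (suc l) (P ∖ y) (c -ᶠ y *ᶠ y))
        ≡⟨ ∑-cong elements (λ y → ind-*-cong ((P ∖ x) y) (step y)) ⟩
      ΣF (λ y → ind ((P ∖ x) y) * (a y + + suc l * b y))
        ≡⟨ ∑-cong elements (λ y → expand (ind ((P ∖ x) y)) (a y) (+ suc l) (b y)) ⟩
      ΣF (λ y → ind ((P ∖ x) y) * a y + + suc l * (ind ((P ∖ x) y) * b y))
        ≡⟨ trans (∑-+ elements _ _) (cong (λ z → tuples (suc (suc l)) (P ∖ x) c + z) (∑-*ˡ elements (+ suc l) _)) ⟩
      tuples (suc (suc l)) (P ∖ x) c + + suc l * tuples (suc l) (P ∖ x) (c -ᶠ x *ᶠ x) ∎
      where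
      a = λ y → tuples (suc l) ((P ∖ x) ∖ y) (c -ᶠ y *ᶠ y)
      b = λ y → tuples l ((P ∖ x) ∖ y) ((c -ᶠ x *ᶠ x) -ᶠ y *ᶠ y)
      step : ∀ y → (P ∖ x) y ≡ true → tuples (suc l) (P ∖ y) (c -ᶠ y *ᶠ y) ≡ a y + + suc l * b y
      step y e = trans (tuples-∖ l (P ∖ y) (∖-true y e) (c -ᶠ y *ᶠ y))
        (cong₂ (λ u v → u + + suc l * v) (tuples-cong (suc l) (∖-comm P y x) _)
          (trans (tuples-cong l (∖-comm P y x) _) (cong (tuples l ((P ∖ x) ∖ y)) (-ᶠ-swap c _ _))))

  nonzero : C → Bool
  nonzero x = not (x == 0ᶠ)

  -- Pairs of a nonzero x and an m-tuple avoiding x, with x² counted i times in the sum.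
  marked : ℕ → ℕ → C → ℤ
  marked m i c = ΣF (λ x → ν x * tuples m (nonzero ∖ x) (c -ᶠ ι i *ᶠ (x *ᶠ x)))

  tuples≡marked : ∀ m c → tuples (suc m) nonzero c ≡ marked m 1 c
  tuples≡marked m c = ∑-cong elements (λ x → cong (λ z → ν x * tuples m (nonzero ∖ x) (c -ᶠ z))
    (sym (trans (cong (_*ᶠ (x *ᶠ x)) (+ᶠ-identityʳ 1ᶠ)) (*ᶠ-identityˡ _))))

  -- The tuples avoiding `x` are all tuples minus those that use `x`. The latter have `x` in one of
  -- `m + 1` positions, and its square joins the marked one, so `i` grows by 1. Iterated, this is
  -- Newton's identity for m! e_m.
  marked-suc : ∀ m i c → marked (suc m) i c
    ≡ ΣF (λ x → ν x * tuples (suc m) nonzero (c -ᶠ ι i *ᶠ (x *ᶠ x))) - + suc m * marked m (suc i) c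
  marked-suc m i c = begin
    ΣF (λ x → ν x * tuples (suc m) (nonzero ∖ x) (c′ x))                  ≡⟨ ∑-cong elements pointwise ⟩
    ΣF (λ x → ν x * tuples (suc m) nonzero (c′ x) - + suc m * (ν x * b x))  ≡⟨ ∑-sub elements _ _ ⟩
    ΣF (λ x → ν x * tuples (suc m) nonzero (c′ x)) - ΣF (λ x → + suc m * (ν x * b x))
      ≡⟨ cong (λ z → ΣF (λ x → ν x * tuples (suc m) nonzero (c′ x)) - z) (∑-*ˡ elements (+ suc m) _) ⟩
    ΣF (λ x → ν x * tuples (suc m) nonzero (c′ x)) - + suc m * marked m (suc i) c ∎
    where
    c′ = λ x → c -ᶠ ι i *ᶠ (x *ᶠ x)
    b = λ x → tuples m (nonzero ∖ x) (c -ᶠ ι (suc i) *ᶠ (x *ᶠ x))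
    expand : ∀ n a s b → n * a ≡ n * (a + s * b) - s * (n * b)
    expand = solve-∀
    shift : ∀ x → c′ x -ᶠ x *ᶠ x ≡ c -ᶠ ι (suc i) *ᶠ (x *ᶠ x)
    shift x = trans (-ᶠ-+ c _ _) (cong (λ z → c -ᶠ z)
      (trans (cong (_+ᶠ ι i *ᶠ (x *ᶠ x)) (sym (*ᶠ-identityˡ _))) (sym (distribᶠʳ (x *ᶠ x) 1ᶠ (ι i)))))
    pointwise : ∀ x → ν x * tuples (suc m) (nonzero ∖ x) (c′ x) ≡ ν x * tuples (suc m) nonzero (c′ x) - + suc m * (ν x * b x)
    pointwise x = trans (expand (ν x) (tuples (suc m) (nonzero ∖ x) (c′ x)) (+ suc m) (b x))
      (cong (_- + suc m * (ν x * b x)) (ind-*-cong (nonzero x) (λ e → sym (trans (tuples-∖ m nonzero e (c′ x))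
        (cong (λ z → tuples (suc m) (nonzero ∖ x) (c′ x) + + suc m * tuples m (nonzero ∖ x) z) (shift x))))))

  count≡∑ : {X : Set} (P : X → Bool) (xs : List X) → + count P xs ≡ ∑ xs (ind ∘ P)
  count≡∑ P []       = refl
  count≡∑ P (x ∷ xs) with P x
  ... | true  = cong (λ z → 1ℤ + z) (count≡∑ P xs)
  ... | false = trans (count≡∑ P xs) (sym (ℤₚ.+-identityˡ _))

  -- The condition counted by `Nstar`, with an arbitrary set of allowed values in place of the
  -- nonzero elements, as the recursion on `k` demands.
  admissible : (k : ℕ) → (C → Bool) → C → (Fin k → C) → Bool
  admissible k P c x = all (P ∘ x) (allFin k)
    ∧ all (λ i → all (λ j → does (i ≟ᶠ j) ∨ not (x i == x j)) (allFin k)) (allFin k)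
    ∧ (sumSq k x == c)

  admissible-suc : ∀ k P c x → admissible (suc k) P c x
    ≡ P (x Fin.zero) ∧ admissible k (P ∖ x Fin.zero) (c -ᶠ x Fin.zero *ᶠ x Fin.zero) (x ∘ Fin.suc)
  admissible-suc k P c x = begin
    admissible (suc k) P c x
      ≡⟨ cong₂ (λ a b → (P x₀ ∧ a) ∧ b ∧ ((x₀ *ᶠ x₀ +ᶠ sumSq k x′) == c)) (all-tabulate Fin.suc (P ∘ x))
           (cong₂ _∧_ row (trans (all-tabulate Fin.suc (λ i → all (pair i) (allFin (suc k)))) columns)) ⟩
    -- Distinctness ranges over ordered pairs, so row 0 and column 0 each contribute `avoid`;
    -- `regroup` merges the two copies.
    (P x₀ ∧ all (P ∘ x′) (allFin k)) ∧ (avoid ∧ (avoid ∧ distinct)) ∧ ((x₀ *ᶠ x₀ +ᶠ sumSq k x′) == c)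
      ≡⟨ regroup (P x₀) _ avoid distinct _ ⟩
    P x₀ ∧ ((all (P ∘ x′) (allFin k) ∧ avoid) ∧ distinct ∧ ((x₀ *ᶠ x₀ +ᶠ sumSq k x′) == c))
      ≡⟨ cong₂ (λ a b → P x₀ ∧ (a ∧ distinct ∧ b)) (sym (all-∧ (allFin k) _ _)) (==-cong⇔ to-rest from-rest) ⟩
    P x₀ ∧ admissible k (P ∖ x₀) (c -ᶠ x₀ *ᶠ x₀) x′ ∎
    where
    x₀ = x Fin.zero
    x′ = x ∘ Fin.suc
    avoid = all (λ i → not (x′ i == x₀)) (allFin k)
    distinct = all (λ i → all (λ j → does (i ≟ᶠ j) ∨ not (x′ i == x′ j)) (allFin k)) (allFin k)
    pair : Fin (suc k) → Fin (suc k) → Bool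
    pair i j = does (i ≟ᶠ j) ∨ not (x i == x j)
    row : all (pair Fin.zero) (allFin (suc k)) ≡ avoid
    row = trans (all-tabulate Fin.suc (pair Fin.zero)) (all-cong (allFin k) (λ j → cong not (==-sym x₀ (x′ j))))
    columns : all (λ i → all (pair (Fin.suc i)) (allFin (suc k))) (allFin k) ≡ avoid ∧ distinct
    columns = trans (all-cong (allFin k) (λ i → cong (not (x′ i == x₀) ∧_) (all-tabulate Fin.suc (pair (Fin.suc i))))) (all-∧ (allFin k) _ _)
    regroup : ∀ p a v d e → (p ∧ a) ∧ (v ∧ (v ∧ d)) ∧ e ≡ p ∧ ((a ∧ v) ∧ d ∧ e)
    regroup false a     v     d e = refl
    regroup true  false v     d e = refl
    regroup true  true  false d e = refl
    regroup true  true  true  d e = refl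
    to-rest : x₀ *ᶠ x₀ +ᶠ sumSq k x′ ≡ c → sumSq k x′ ≡ c -ᶠ x₀ *ᶠ x₀
    to-rest e = trans (sym (x+c-c (x₀ *ᶠ x₀) (sumSq k x′))) (cong (_-ᶠ x₀ *ᶠ x₀) (trans (+ᶠ-comm _ _) e))
    from-rest : sumSq k x′ ≡ c -ᶠ x₀ *ᶠ x₀ → x₀ *ᶠ x₀ +ᶠ sumSq k x′ ≡ c
    from-rest e = trans (+ᶠ-comm _ _) (trans (cong (_+ᶠ x₀ *ᶠ x₀) e) (x-c+c _ c))

  ∑-admissible : ∀ k P c → ∑ (allFuns k q) (λ f → ind (admissible k P c (to ∘ f))) ≡ tuples k P c
  ∑-admissible zero    P c = trans (ℤₚ.+-identityʳ _) (cong ind (==-sym 0ᶠ c))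
  ∑-admissible (suc k) P c = begin
    ∑ (allFuns (suc k) q) G
      ≡⟨ ∑-concatMap (λ i → map (i ∷ᶠ_) (allFuns k q)) (allFin q) G ⟩
    ∑ (allFin q) (λ i → ∑ (map (i ∷ᶠ_) (allFuns k q)) G)
      ≡⟨ ∑-cong (allFin q) (λ i → trans (∑-map (i ∷ᶠ_) (allFuns k q) G) (trans (∑-cong (allFuns k q) (pointwise i))
           (trans (∑-*ˡ (allFuns k q) (ind (P (to i))) _) (cong (ind (P (to i)) *_) (∑-admissible k _ _))))) ⟩
    ∑ (allFin q) (λ i → ind (P (to i)) * tuples k (P ∖ to i) (c -ᶠ to i *ᶠ to i))
      ≡⟨ sym (∑-map to (allFin q) _) ⟩
    tuples (suc k) P c ∎
    where
    G = λ f → ind (admissible (suc k) P c (to ∘ f))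
    ind-∧ : ∀ a b → ind (a ∧ b) ≡ ind a * ind b
    ind-∧ true  b = sym (ℤₚ.*-identityˡ _)
    ind-∧ false b = refl
    pointwise : ∀ i f → G (i ∷ᶠ f) ≡ ind (P (to i)) * ind (admissible k (P ∖ to i) (c -ᶠ to i *ᶠ to i) (to ∘ f))
    pointwise i f = trans (cong ind (admissible-suc k P c (to ∘ (i ∷ᶠ f)))) (ind-∧ (P (to i)) _)

  Nstar≡tuples : ∀ k b → + Nstar F k b ≡ tuples k nonzero b
  Nstar≡tuples k b = begin
    + Nstar F k b                                                       ≡⟨ count≡∑ _ (allTuples F k) ⟩
    ∑ (allTuples F k) (λ x → ind (admissible k nonzero b x))            ≡⟨ ∑-map _ (allFuns k q) _ ⟩
    ∑ (allFuns k q) (λ f → ind (admissible k nonzero b (to ∘ f)))       ≡⟨ ∑-admissible k nonzero b ⟩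
    tuples k nonzero b                                                  ∎

-- The ring of integers with a square root of D adjoined.

module QuadraticRing (D : ℤ) where
  open RingR D public

  isCommutativeRing : IsCommutativeRing _≡_ _⊕_ _⊗_ ⊝_ (emb 0ℤ) 𝟙
  isCommutativeRing = record
    { isRing = record
      { +-isAbelianGroup = record
        { isGroup = record
          { isMonoid = record
            { isSemigroup = record
              { isMagma = record { isEquivalence = isEquivalence ; ∙-cong = cong₂ _⊕_ }
              ; assoc = λ { ⟨ a + b r⟩ ⟨ c + d r⟩ ⟨ e + f r⟩ → cong₂ ⟨_+_r⟩ (ℤₚ.+-assoc a c e) (ℤₚ.+-assoc b d f) } }
            ; identity = (λ { ⟨ a + b r⟩ → cong₂ ⟨_+_r⟩ (ℤₚ.+-identityˡ a) (ℤₚ.+-identityˡ b) })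
                       , (λ { ⟨ a + b r⟩ → cong₂ ⟨_+_r⟩ (ℤₚ.+-identityʳ a) (ℤₚ.+-identityʳ b) }) }
          ; inverse = (λ { ⟨ a + b r⟩ → cong₂ ⟨_+_r⟩ (ℤₚ.+-inverseˡ a) (ℤₚ.+-inverseˡ b) })
                    , (λ { ⟨ a + b r⟩ → cong₂ ⟨_+_r⟩ (ℤₚ.+-inverseʳ a) (ℤₚ.+-inverseʳ b) })
          ; ⁻¹-cong = cong ⊝_ }
        ; comm = λ { ⟨ a + b r⟩ ⟨ c + d r⟩ → cong₂ ⟨_+_r⟩ (ℤₚ.+-comm a c) (ℤₚ.+-comm b d) } }
      ; *-cong = cong₂ _⊗_
      ; *-assoc = λ { ⟨ a + b r⟩ ⟨ c + d r⟩ ⟨ e + f r⟩ → cong₂ ⟨_+_r⟩ (assoc-re a b c d e f D) (assoc-im a b c d e f D) }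
      ; *-identity = (λ { ⟨ a + b r⟩ → cong₂ ⟨_+_r⟩ (idˡ-re a b D) (idˡ-im a b) })
                   , (λ { ⟨ a + b r⟩ → cong₂ ⟨_+_r⟩ (idʳ-re a b D) (idʳ-im a b) })
      ; distrib = (λ { ⟨ a + b r⟩ ⟨ c + d r⟩ ⟨ e + f r⟩ → cong₂ ⟨_+_r⟩ (distˡ-re a b c d e f D) (distˡ-im a b c d e f) })
                , (λ { ⟨ a + b r⟩ ⟨ c + d r⟩ ⟨ e + f r⟩ → cong₂ ⟨_+_r⟩ (distʳ-re a b c d e f D) (distʳ-im a b c d e f) }) }
    ; *-comm = λ { ⟨ a + b r⟩ ⟨ c + d r⟩ → cong₂ ⟨_+_r⟩ (comm-re a b c d D) (comm-im a b c d) } }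
    where
    assoc-re : ∀ a b c d e f D → (a * c + b * d * D) * e + (a * d + b * c) * f * D ≡ a * (c * e + d * f * D) + b * (c * f + d * e) * D
    assoc-re = solve-∀
    assoc-im : ∀ a b c d e f D → (a * c + b * d * D) * f + (a * d + b * c) * e ≡ a * (c * f + d * e) + b * (c * e + d * f * D)
    assoc-im = solve-∀
    idˡ-re : ∀ a b D → 1ℤ * a + 0ℤ * b * D ≡ a
    idˡ-re = solve-∀
    idˡ-im : ∀ a b → 1ℤ * b + 0ℤ * a ≡ b
    idˡ-im = solve-∀
    idʳ-re : ∀ a b D → a * 1ℤ + b * 0ℤ * D ≡ a
    idʳ-re = solve-∀
    idʳ-im : ∀ a b → a * 0ℤ + b * 1ℤ ≡ b
    idʳ-im = solve-∀
    distˡ-re : ∀ a b c d e f D → a * (c + e) + b * (d + f) * D ≡ (a * c + b * d * D) + (a * e + b * f * D)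
    distˡ-re = solve-∀
    distˡ-im : ∀ a b c d e f → a * (d + f) + b * (c + e) ≡ (a * d + b * c) + (a * f + b * e)
    distˡ-im = solve-∀
    distʳ-re : ∀ a b c d e f D → (c + e) * a + (d + f) * b * D ≡ (c * a + d * b * D) + (e * a + f * b * D)
    distʳ-re = solve-∀
    distʳ-im : ∀ a b c d e f → (c + e) * b + (d + f) * a ≡ (c * b + d * a) + (e * b + f * a)
    distʳ-im = solve-∀
    comm-re : ∀ a b c d D → a * c + b * d * D ≡ c * a + d * b * D
    comm-re = solve-∀
    comm-im : ∀ a b c d → a * d + b * c ≡ c * b + d * a
    comm-im = solve-∀

  ringR : CommutativeRing 0ℓ 0ℓ
  ringR = record { isCommutativeRing = isCommutativeRing }

-- Counting permutations by cycle type.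

module ℕSums = Sums ℕₚ.+-*-commutativeSemiring

-- The falling factorial on ℕ. It is 0 for `n > m`, so that sums over cycle lengths may run up to
-- any larger bound.
fall : ℕ → ℕ → ℕ
fall m       zero    = 1
fall zero    (suc n) = 0
fall (suc m) (suc n) = suc m ℕ.* fall m n

fall-! : ∀ n r → fall (n ℕ.+ r) n ℕ.* r ! ≡ (n ℕ.+ r) !
fall-! zero    r = ℕₚ.*-identityˡ (r !)
fall-! (suc n) r = trans (ℕₚ.*-assoc (suc n ℕ.+ r) (fall (n ℕ.+ r) n) (r !)) (cong ((suc n ℕ.+ r) ℕ.*_) (fall-! n r))

fall-< : ∀ {m n} → m < n → fall m n ≡ 0
fall-< {zero}  {suc n} _         = refl
fall-< {suc m} {suc n} (s≤s m<n) = trans (cong (suc m ℕ.*_) (fall-< m<n)) (ℕₚ.*-zeroʳ (suc m))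

sg : ℕ → ℕ
sg zero    = 0
sg (suc _) = 1

get : ℕ → List ℕ → ℕ
get n       []       = 0
get zero    (c ∷ cs) = c
get (suc n) (c ∷ cs) = get n cs

-- Removes one cycle of length `n + 1`: the entry with index 0 counts fixed points. An entry 0 stays
-- 0; this default is masked by a factor `sg (get n cs)` or excluded by a hypothesis.
dec : ℕ → List ℕ → List ℕ
dec n       []       = []
dec zero    (c ∷ cs) = pred c ∷ cs
dec (suc n) (c ∷ cs) = c ∷ dec n cs

module CycleTypes (D : ℤ) where
  open RingR D
  open ≡-Reasoning

  weight-dec : ∀ n j cs {x} → get n cs ≡ suc x → weightFrom j cs ≡ (j ℕ.+ n) ℕ.+ weightFrom j (dec n cs)
  weight-dec n       j []       ()
  weight-dec zero    j (c ∷ cs) {x} refl = expand j x (weightFrom (suc j) cs)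
    where
    expand : ∀ j x w → j ℕ.* suc x ℕ.+ w ≡ (j ℕ.+ 0) ℕ.+ (j ℕ.* x ℕ.+ w)
    expand = ℕ-Solver.solve-∀
  weight-dec (suc n) j (c ∷ cs) e = trans (cong (λ w → j ℕ.* c ℕ.+ w) (weight-dec n (suc j) cs e))
    (rearrange j n c (weightFrom (suc j) (dec n cs)))
    where
    rearrange : ∀ j n c w → j ℕ.* c ℕ.+ ((suc j ℕ.+ n) ℕ.+ w) ≡ (j ℕ.+ suc n) ℕ.+ (j ℕ.* c ℕ.+ w)
    rearrange = ℕ-Solver.solve-∀

  denom-dec : ∀ n j cs {x} → get n cs ≡ suc x →
              denomFrom j cs ≡ (j ℕ.+ n) ℕ.* suc x ℕ.* denomFrom j (dec n cs)
  denom-dec n       j []       ()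
  denom-dec zero    j (c ∷ cs) {x} refl = rearrange j (j ℕ.^ x) (suc x) (x !) (denomFrom (suc j) cs)
    where
    rearrange : ∀ j a s f d → (j ℕ.* a) ℕ.* (s ℕ.* f) ℕ.* d ≡ (j ℕ.+ 0) ℕ.* s ℕ.* (a ℕ.* f ℕ.* d)
    rearrange = ℕ-Solver.solve-∀
  denom-dec (suc n) j (c ∷ cs) {x} e = trans (cong (λ w → j ℕ.^ c ℕ.* c ! ℕ.* w) (denom-dec n (suc j) cs e))
    (rearrange (j ℕ.^ c) (c !) j n (suc x) (denomFrom (suc j) (dec n cs)))
    where
    rearrange : ∀ a f j n s d → a ℕ.* f ℕ.* ((suc j ℕ.+ n) ℕ.* s ℕ.* d) ≡ (j ℕ.+ suc n) ℕ.* s ℕ.* (a ℕ.* f ℕ.* d)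
    rearrange = ℕ-Solver.solve-∀

  denom-nonZero : ∀ j cs → NonZero (denomFrom (suc j) cs)
  denom-nonZero j []       = _
  denom-nonZero j (c ∷ cs) = ℕₚ.m*n≢0 _ _ {{ℕₚ.m*n≢0 _ _ {{ℕₚ.m^n≢0 (suc j) c}} {{c ℕₚ.!≢0}}}} {{denom-nonZero (suc j) cs}}

  weight-∑ : ∀ j cs → weightFrom j cs ≡ ℕSums.∑< (length cs) (λ n → (j ℕ.+ n) ℕ.* get n cs)
  weight-∑ j []       = refl
  weight-∑ j (c ∷ cs) = cong₂ (λ x y → x ℕ.* c ℕ.+ y) (sym (ℕₚ.+-identityʳ j))
    (trans (weight-∑ (suc j) cs) (ℕSums.∑<-cong (length cs) (λ n _ → cong (ℕ._* get n cs) (sym (ℕₚ.+-suc j n)))))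

  get≤weight : ∀ n j cs → get n cs ≤ weightFrom (suc j) cs
  get≤weight n       j []       = z≤n
  get≤weight zero    j (c ∷ cs) = ℕₚ.≤-trans (ℕₚ.m≤m+n c (j ℕ.* c)) (ℕₚ.m≤m+n _ _)
  get≤weight (suc n) j (c ∷ cs) = ℕₚ.≤-trans (get≤weight n (suc j) cs) (ℕₚ.m≤n+m _ _)

  div-exact : ∀ n d → .{{NonZero d}} → d ∣ n → (n div d) ℕ.* d ≡ n
  div-exact n (suc d) (divides m refl) = cong (ℕ._* suc d) (m*n/n≡m m (suc d))

  Exact : ℕ → List ℕ → Set
  Exact m cs = Ncount m cs ℕ.* denomFrom 1 cs ≡ m !

  -- The number of permutations of `m + 1` points with cycle type `cs` in which a marked point lies
  -- on a cycle of length `n + 1`: `fall m n` ordered choices complete that cycle, and the other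
  -- `m - n` points carry the type `dec n cs`.
  slot : ℕ → List ℕ → ℕ → ℕ
  slot m cs n = sg (get n cs) ℕ.* (fall m n ℕ.* Ncount (m ∸ n) (dec n cs))

  -- m! c_n (n+1) / denom(c) is the (n+1)-st term of the recursion, by denom(c) = (n+1) c_n denom(c - e_n).
  slot-denom : ∀ m cs → weightFrom 1 cs ≡ suc m → (∀ m′ cs′ → m′ ≤ m → weightFrom 1 cs′ ≡ m′ → Exact m′ cs′) →
               ∀ n → slot m cs n ℕ.* denomFrom 1 cs ≡ m ! ℕ.* (suc n ℕ.* get n cs)
  slot-denom m cs wt exact n with get n cs in e
  ... | zero  = sym (trans (cong (m ! ℕ.*_) (ℕₚ.*-zeroʳ n)) (ℕₚ.*-zeroʳ (m !)))
  ... | suc x = begin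
    1 ℕ.* (fall m n ℕ.* Ncount (m ∸ n) cs′) ℕ.* denomFrom 1 cs
      ≡⟨ cong (1 ℕ.* (fall m n ℕ.* Ncount (m ∸ n) cs′) ℕ.*_) (denom-dec n 1 cs e) ⟩
    1 ℕ.* (fall m n ℕ.* Ncount (m ∸ n) cs′) ℕ.* (suc n ℕ.* suc x ℕ.* denomFrom 1 cs′)
      ≡⟨ rearrange (fall m n) (Ncount (m ∸ n) cs′) (suc n ℕ.* suc x) (denomFrom 1 cs′) ⟩
    fall m n ℕ.* (Ncount (m ∸ n) cs′ ℕ.* denomFrom 1 cs′) ℕ.* (suc n ℕ.* suc x)
      ≡⟨ cong (λ z → fall m n ℕ.* z ℕ.* (suc n ℕ.* suc x)) (exact (m ∸ n) cs′ (ℕₚ.m∸n≤m m n) wt′) ⟩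
    fall m n ℕ.* (m ∸ n) ! ℕ.* (suc n ℕ.* suc x)
      ≡⟨ cong (λ z → fall z n ℕ.* (m ∸ n) ! ℕ.* (suc n ℕ.* suc x)) (sym n+[m∸n]≡m) ⟩
    fall (n ℕ.+ (m ∸ n)) n ℕ.* (m ∸ n) ! ℕ.* (suc n ℕ.* suc x)
      ≡⟨ cong (ℕ._* (suc n ℕ.* suc x)) (trans (fall-! n (m ∸ n)) (cong _! n+[m∸n]≡m)) ⟩
    m ! ℕ.* (suc n ℕ.* suc x) ∎
    where
    cs′ = dec n cs
    m≡n+wt′ : m ≡ n ℕ.+ weightFrom 1 cs′
    m≡n+wt′ = ℕₚ.suc-injective (trans (sym wt) (weight-dec n 1 cs e))
    wt′ : weightFrom 1 cs′ ≡ m ∸ n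
    wt′ = sym (trans (cong (_∸ n) m≡n+wt′) (ℕₚ.m+n∸m≡n n _))
    n+[m∸n]≡m : n ℕ.+ (m ∸ n) ≡ m
    n+[m∸n]≡m = trans (cong (n ℕ.+_) (sym wt′)) (sym m≡n+wt′)
    rearrange : ∀ f N s d → 1 ℕ.* (f ℕ.* N) ℕ.* (s ℕ.* d) ≡ f ℕ.* (N ℕ.* d) ℕ.* s
    rearrange = ℕ-Solver.solve-∀

  -- The multiplicities `(n + 1) c_n` add up to the weight `m + 1`, which raises `m !` to the next
  -- factorial.
  slots-denom : ∀ m cs → weightFrom 1 cs ≡ suc m → (∀ m′ cs′ → m′ ≤ m → weightFrom 1 cs′ ≡ m′ → Exact m′ cs′) →
                ℕSums.∑< (length cs) (slot m cs) ℕ.* denomFrom 1 cs ≡ suc m !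
  slots-denom m cs wt exact = begin
    ℕSums.∑< (length cs) (slot m cs) ℕ.* denomFrom 1 cs                  ≡⟨ sym (ℕSums.∑<-*ʳ (length cs) (denomFrom 1 cs) (slot m cs)) ⟩
    ℕSums.∑< (length cs) (λ n → slot m cs n ℕ.* denomFrom 1 cs)          ≡⟨ ℕSums.∑<-cong (length cs) (λ n _ → slot-denom m cs wt exact n) ⟩
    ℕSums.∑< (length cs) (λ n → m ! ℕ.* (suc n ℕ.* get n cs))            ≡⟨ ℕSums.∑<-*ˡ (length cs) (m !) _ ⟩
    m ! ℕ.* ℕSums.∑< (length cs) (λ n → suc n ℕ.* get n cs)              ≡⟨ cong (m ! ℕ.*_) (trans (sym (weight-∑ 1 cs)) wt) ⟩
    m ! ℕ.* suc m                                                        ≡⟨ ℕₚ.*-comm (m !) (suc m) ⟩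
    suc m !                                                              ∎

  denom-weight-0 : ∀ j cs → weightFrom (suc j) cs ≡ 0 → denomFrom (suc j) cs ≡ 1
  denom-weight-0 j []           _ = refl
  denom-weight-0 j (zero ∷ cs)  e = trans (ℕₚ.+-identityʳ _)
    (denom-weight-0 (suc j) cs (trans (cong (ℕ._+ weightFrom (suc (suc j)) cs) (sym (ℕₚ.*-zeroʳ j))) e))
  denom-weight-0 j (suc c ∷ cs) ()

  -- `Ncount` is a truncated quotient, so divisibility needs a proof. The sum of the slots is the
  -- integer quotient, by strong induction on the weight; `M` bounds the weight and makes the
  -- induction structural.
  exact-upto : ∀ M m cs → m ≤ M → weightFrom 1 cs ≡ m → Exact m cs
  exact-upto M zero cs _ wt rewrite denom-weight-0 0 cs wt = refl
  exact-upto (suc M) (suc m) cs (s≤s m≤M) wt = div-exact (suc m !) (denomFrom 1 cs) {{denom-nonZero 0 cs}}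
    (divides (ℕSums.∑< (length cs) (slot m cs)) (sym (slots-denom m cs wt (λ m′ cs′ m′≤m → exact-upto M m′ cs′ (ℕₚ.≤-trans m′≤m m≤M)))))

  Ncount-rec : ∀ m cs → weightFrom 1 cs ≡ suc m → Ncount (suc m) cs ≡ ℕSums.∑< (length cs) (slot m cs)
  Ncount-rec m cs wt = ℕₚ.*-cancelʳ-≡ _ _ (denomFrom 1 cs) {{denom-nonZero 0 cs}}
    (trans (exact-upto (suc m) (suc m) cs ℕₚ.≤-refl wt) (sym (slots-denom m cs wt (λ m′ cs′ _ → exact-upto m′ m′ cs′ ℕₚ.≤-refl))))

-- The cycle index and its recursion.

module CycleIndex {R : Set} {_⊞_ _⊠_ : R → R → R} {𝟘 𝟏 : R}
                  (isCommutativeSemiring : IsCommutativeSemiring _≡_ _⊞_ _⊠_ 𝟘 𝟏) (T : ℕ → R) where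
  infixl 6 _⊕_
  infixl 7 _⊗_
  _⊕_ _⊗_ : R → R → R
  _⊕_ = _⊞_
  _⊗_ = _⊠_

  semiringR : CommutativeSemiring 0ℓ 0ℓ
  semiringR = record { isCommutativeSemiring = isCommutativeSemiring }

  open Sums semiringR
  open CommutativeSemiring semiringR using ()
    renaming ( +-identityˡ to ⊕-identityˡ; +-identityʳ to ⊕-identityʳ; +-assoc to ⊕-assoc
             ; *-assoc to ⊗-assoc; *-identityˡ to ⊗-identityˡ
             ; zeroˡ to ⊗-zeroˡ; zeroʳ to ⊗-zeroʳ; distribʳ to ⊗-distribʳ)
  open import Algebra.Properties.CommutativeSemigroup (CommutativeSemiring.*-commutativeSemigroup semiringR) using ()
    renaming (x∙yz≈y∙xz to ⊗-swap)
  open ≡-Reasoning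

  embℕ : ℕ → R
  embℕ zero    = 𝟘
  embℕ (suc n) = 𝟏 ⊕ embℕ n

  embℕ-+ : ∀ m n → embℕ (m ℕ.+ n) ≡ embℕ m ⊕ embℕ n
  embℕ-+ zero    n = sym (⊕-identityˡ _)
  embℕ-+ (suc m) n = trans (cong (𝟏 ⊕_) (embℕ-+ m n)) (sym (⊕-assoc 𝟏 _ _))

  embℕ-* : ∀ m n → embℕ (m ℕ.* n) ≡ embℕ m ⊗ embℕ n
  embℕ-* zero    n = sym (⊗-zeroˡ _)
  embℕ-* (suc m) n = trans (embℕ-+ n (m ℕ.* n))
    (trans (cong₂ _⊕_ (sym (⊗-identityˡ _)) (embℕ-* m n)) (sym (⊗-distribʳ (embℕ n) 𝟏 (embℕ m))))

  embℕ-1 : embℕ 1 ≡ 𝟏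
  embℕ-1 = ⊕-identityʳ 𝟏

  0⊗ : ∀ {x} y → x ≡ 𝟘 → x ⊗ y ≡ 𝟘
  0⊗ y e = trans (cong (_⊗ y) e) (⊗-zeroˡ y)

  ⊗0 : ∀ x {y} → y ≡ 𝟘 → x ⊗ y ≡ 𝟘
  ⊗0 x e = trans (cong (x ⊗_) e) (⊗-zeroʳ x)

  1⊗ : ∀ {x} y → x ≡ 𝟏 → x ⊗ y ≡ y
  1⊗ y e = trans (cong (_⊗ y) e) (⊗-identityˡ y)

  pow : R → ℕ → R
  pow x zero    = 𝟏
  pow x (suc n) = x ⊗ pow x n

  mono : ℕ → List ℕ → R
  mono j []       = 𝟏
  mono j (c ∷ cs) = pow (T j) c ⊗ mono (suc j) cs

  mutual
    cyc : ℕ → R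
    cyc zero    = 𝟏
    cyc (suc m) = cycTail m 1

    -- A Horner form of the sum of `fall m n * T (j + n) * cyc (m - n)` over `n`, where `n` extends
    -- the cycle through a marked point. The nesting is chosen to match `marked-suc`, so that
    -- `cycTail m j` can mirror `marked m j`.
    cycTail : ℕ → ℕ → R
    cycTail zero    j = T j ⊗ cyc zero
    cycTail (suc m) j = T j ⊗ cyc (suc m) ⊕ embℕ (suc m) ⊗ cycTail m (suc j)

  cycTerm : ℕ → ℕ → ℕ → R
  cycTerm m j n = embℕ (fall m n) ⊗ (T (j ℕ.+ n) ⊗ cyc (m ∸ n))

  -- The bound `L` may exceed `m` because `fall` vanishes there; the recursion for `A[ K ]` has `K`
  -- terms for every `m`.
  cycTail-∑ : ∀ m j L → m ≤ L → cycTail m j ≡ ∑< (suc L) (cycTerm m j)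
  cycTail-∑ m j L m≤L = sym (trans (cong (_⊕ ∑< L (cycTerm m j ∘ suc)) first) (rest m L m≤L))
    where
    first : cycTerm m j 0 ≡ T j ⊗ cyc m
    first = trans (1⊗ _ embℕ-1) (cong (λ i → T i ⊗ cyc m) (ℕₚ.+-identityʳ j))
    rest : ∀ m L → m ≤ L → T j ⊗ cyc m ⊕ ∑< L (cycTerm m j ∘ suc) ≡ cycTail m j
    rest zero    L       _         = trans (cong (T j ⊗ 𝟏 ⊕_) (trans (∑<-cong L (λ n _ → ⊗-zeroˡ _)) (∑<-zero L))) (⊕-identityʳ _)
    rest (suc m) (suc L) (s≤s m≤L) = cong (T j ⊗ cyc (suc m) ⊕_) (begin
      ∑< (suc L) (cycTerm (suc m) j ∘ suc)                         ≡⟨ ∑<-cong (suc L) (λ n _ → shift n) ⟩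
      ∑< (suc L) (λ n → embℕ (suc m) ⊗ cycTerm m (suc j) n)        ≡⟨ ∑<-*ˡ (suc L) (embℕ (suc m)) (cycTerm m (suc j)) ⟩
      embℕ (suc m) ⊗ ∑< (suc L) (cycTerm m (suc j))                ≡⟨ cong (embℕ (suc m) ⊗_) (sym (cycTail-∑ m (suc j) L m≤L)) ⟩
      embℕ (suc m) ⊗ cycTail m (suc j)                             ∎)
      where
      shift : ∀ n → cycTerm (suc m) j (suc n) ≡ embℕ (suc m) ⊗ cycTerm m (suc j) n
      shift n = trans (cong₂ (λ x i → x ⊗ (T i ⊗ cyc (m ∸ n))) (embℕ-* (suc m) (fall m n)) (ℕₚ.+-suc j n))
                      (⊗-assoc (embℕ (suc m)) (embℕ (fall m n)) _)

  mono-dec : ∀ n j cs {x} → get n cs ≡ suc x → mono j cs ≡ T (j ℕ.+ n) ⊗ mono j (dec n cs)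
  mono-dec n       j []       ()
  mono-dec zero    j (c ∷ cs) {x} refl = trans (⊗-assoc (T j) (pow (T j) x) _)
    (cong (λ i → T i ⊗ (pow (T j) x ⊗ mono (suc j) cs)) (sym (ℕₚ.+-identityʳ j)))
  mono-dec (suc n) j (c ∷ cs) e = trans (cong (pow (T j) c ⊗_) (mono-dec n (suc j) cs e))
    (trans (⊗-swap (pow (T j) c) _ _) (cong (λ i → T i ⊗ (pow (T j) c ⊗ mono (suc j) (dec n cs))) (sym (ℕₚ.+-suc j n))))

  module _ (D : ℤ) where
    open RingR D using (allVecs; weightFrom; denomFrom; Ncount; _div_)
    open CycleTypes D

    ∑-allVecs-suc : ∀ L B (g : List ℕ → R) →
                    ∑ (allVecs (suc L) B) g ≡ ∑< (suc B) (λ c → ∑ (allVecs L B) (λ cs → g (c ∷ cs)))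
    ∑-allVecs-suc L B g = trans (∑-concatMap (λ c → map (c ∷_) (allVecs L B)) (upTo (suc B)) g)
      (trans (∑-applyUpTo id (suc B) (λ c → ∑ (map (c ∷_) (allVecs L B)) g)) (∑<-cong (suc B) (λ c _ → ∑-map (c ∷_) (allVecs L B) g)))

    ∑-allVecs-cong : ∀ L B {g h : List ℕ → R} → (∀ cs → length cs ≡ L → g cs ≡ h cs) →
                     ∑ (allVecs L B) g ≡ ∑ (allVecs L B) h
    ∑-allVecs-cong zero    B g≡h = cong (_⊕ 𝟘) (g≡h [] refl)
    ∑-allVecs-cong (suc L) B {g} {h} g≡h = trans (∑-allVecs-suc L B g)
      (trans (∑<-cong (suc B) (λ c _ → ∑-allVecs-cong L B (λ cs e → g≡h (c ∷ cs) (cong suc e)))) (sym (∑-allVecs-suc L B h)))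

    ∑<-truncate : ∀ B (G : ℕ → R) → ∑< (suc B) (λ c → embℕ (sg (B ∸ c)) ⊗ G c) ≡ ∑< B G
    ∑<-truncate zero    G = trans (⊕-identityʳ _) (⊗-zeroˡ (G 0))
    ∑<-truncate (suc B) G = cong₂ _⊕_ (1⊗ (G 0) embℕ-1) (∑<-truncate B (G ∘ suc))

    -- Lowering entry `n` maps the vectors with a positive entry there bijectively onto those whose
    -- entry is below `B`; the two indicators select these sets.
    ∑-dec : ∀ n L B (g : List ℕ → R) → n < L →
            ∑ (allVecs L B) (λ cs → embℕ (sg (get n cs)) ⊗ g (dec n cs)) ≡ ∑ (allVecs L B) (λ cs → embℕ (sg (B ∸ get n cs)) ⊗ g cs)
    ∑-dec zero (suc L) B g _ = begin
      ∑ (allVecs (suc L) B) _                                                       ≡⟨ ∑-allVecs-suc L B _ ⟩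
      ∑< (suc B) (λ c → ∑ (allVecs L B) (λ cs → embℕ (sg c) ⊗ g (pred c ∷ cs)))     ≡⟨ ∑<-cong (suc B) (λ c _ → ∑-*ˡ (allVecs L B) (embℕ (sg c)) (λ cs → g (pred c ∷ cs))) ⟩
      ∑< (suc B) (λ c → embℕ (sg c) ⊗ G (pred c))                                   ≡⟨ cong (_⊕ ∑< B (λ c → embℕ 1 ⊗ G c)) (⊗-zeroˡ (G 0)) ⟩
      𝟘 ⊕ ∑< B (λ c → embℕ 1 ⊗ G c)                                                 ≡⟨ trans (⊕-identityˡ _) (∑<-cong B (λ c _ → 1⊗ (G c) embℕ-1)) ⟩
      ∑< B G                                                                        ≡⟨ sym (∑<-truncate B G) ⟩
      ∑< (suc B) (λ c → embℕ (sg (B ∸ c)) ⊗ G c)                                    ≡⟨ ∑<-cong (suc B) (λ c _ → sym (∑-*ˡ (allVecs L B) (embℕ (sg (B ∸ c))) (λ cs → g (c ∷ cs)))) ⟩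
      ∑< (suc B) (λ c → ∑ (allVecs L B) (λ cs → embℕ (sg (B ∸ c)) ⊗ g (c ∷ cs)))    ≡⟨ sym (∑-allVecs-suc L B _) ⟩
      ∑ (allVecs (suc L) B) _                                                       ∎
      where
      G : ℕ → R
      G c = ∑ (allVecs L B) (λ cs → g (c ∷ cs))
    ∑-dec (suc n) (suc L) B g (s≤s n<L) = trans (∑-allVecs-suc L B _)
      (trans (∑<-cong (suc B) (λ c _ → ∑-dec n L B (λ cs → g (c ∷ cs)) n<L)) (sym (∑-allVecs-suc L B _)))

    -- Expresses the `filter` in the definition of `A` as a factor, so that sums can be exchanged.
    [_≐_] : ℕ → ℕ → R
    [ m ≐ n ] with does (m ℕ.≟ n)
    ... | true  = 𝟏
    ... | false = 𝟘

    ≐-≡ : ∀ {m n} → m ≡ n → [ m ≐ n ] ≡ 𝟏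
    ≐-≡ {m} {n} e rewrite dec-true (m ℕ.≟ n) e = refl

    ≐-≢ : ∀ {m n} → ¬ m ≡ n → [ m ≐ n ] ≡ 𝟘
    ≐-≢ {m} {n} e rewrite dec-false (m ℕ.≟ n) e = refl

    summand : ℕ → List ℕ → R
    summand m cs = embℕ (Ncount m cs) ⊗ mono 1 cs

    -- The box of vectors (`K`) is separated from the weight (`m`): the recursion lowers the weight
    -- while the box stays fixed. `A` itself is the diagonal `A[ k ] k`.
    A[_] : ℕ → ℕ → R
    A[ K ] m = ∑ (allVecs K K) (λ cs → [ weightFrom 1 cs ≐ m ] ⊗ summand m cs)

    ∑-weight-0 : ∀ L B j (f : List ℕ → R) → ∑ (allVecs L B) (λ cs → [ weightFrom (suc j) cs ≐ 0 ] ⊗ f cs) ≡ f (replicate L 0)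
    ∑-weight-0 zero    B j f = trans (⊕-identityʳ _) (⊗-identityˡ _)
    ∑-weight-0 (suc L) B j f = begin
      ∑ (allVecs (suc L) B) _                  ≡⟨ ∑-allVecs-suc L B _ ⟩
      ∑ (allVecs L B) (G 0) ⊕ ∑< B (λ c → ∑ (allVecs L B) (G (suc c)))
        ≡⟨ cong₂ _⊕_ (trans (∑-cong (allVecs L B) (λ cs → cong (λ z → [ z ℕ.+ weightFrom (suc (suc j)) cs ≐ 0 ] ⊗ f (0 ∷ cs)) (ℕₚ.*-zeroʳ j)))
                            (∑-weight-0 L B (suc j) (f ∘ (0 ∷_))))
                     (trans (∑<-cong B (λ c _ → trans (∑-cong (allVecs L B) (λ cs → ⊗-zeroˡ (f (suc c ∷ cs)))) (∑-zero (allVecs L B)))) (∑<-zero B)) ⟩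
      f (replicate (suc L) 0) ⊕ 𝟘         ≡⟨ ⊕-identityʳ _ ⟩
      f (replicate (suc L) 0)                  ∎
      where
      G : ℕ → List ℕ → R
      G c cs = [ weightFrom (suc j) (c ∷ cs) ≐ 0 ] ⊗ f (c ∷ cs)

    A[]-zero : ∀ K → A[ K ] 0 ≡ 𝟏
    A[]-zero K = trans (∑-weight-0 K K 0 (summand 0)) (trans (cong₂ (λ d x → embℕ (1 div d) ⊗ x) (denom-zero K 1) (mono-zero K 1)) (1⊗ 𝟏 embℕ-1))
      where
      denom-zero : ∀ L j → denomFrom j (replicate L 0) ≡ 1
      denom-zero zero    j = refl
      denom-zero (suc L) j = trans (ℕₚ.+-identityʳ _) (denom-zero L (suc j))
      mono-zero : ∀ L j → mono j (replicate L 0) ≡ 𝟏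
      mono-zero zero    j = refl
      mono-zero (suc L) j = trans (⊗-identityˡ _) (mono-zero L (suc j))

    embℕ-∑< : ∀ L (f : ℕ → ℕ) → embℕ (ℕSums.∑< L f) ≡ ∑< L (embℕ ∘ f)
    embℕ-∑< zero    f = refl
    embℕ-∑< (suc L) f = trans (embℕ-+ (f 0) _) (cong (embℕ (f 0) ⊕_) (embℕ-∑< L (f ∘ suc)))

    -- What a cycle type contributes after the loss of a cycle of length `n + 1`. The weight
    -- condition avoids `m ∸ n`; `∑-reduced` introduces it, with `fall` covering the case `n > m`.
    reduced : ℕ → ℕ → List ℕ → R
    reduced m n cs = embℕ (fall m n) ⊗ (T (suc n) ⊗ ([ n ℕ.+ weightFrom 1 cs ≐ m ] ⊗ summand (m ∸ n) cs))

    summand-slot : ∀ m cs n → [ weightFrom 1 cs ≐ suc m ] ⊗ (embℕ (slot m cs n) ⊗ mono 1 cs) ≡ embℕ (sg (get n cs)) ⊗ reduced m n (dec n cs)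
    summand-slot m cs n with get n cs in e
    ... | zero  = trans (⊗0 [ weightFrom 1 cs ≐ suc m ] (⊗-zeroˡ (mono 1 cs))) (sym (⊗-zeroˡ (reduced m n (dec n cs))))
    ... | suc x = begin
      [ weightFrom 1 cs ≐ suc m ] ⊗ (embℕ (1 ℕ.* (fall m n ℕ.* N)) ⊗ mono 1 cs)
        ≡⟨ cong₂ (λ i z → i ⊗ (embℕ z ⊗ mono 1 cs)) same-weight (ℕₚ.*-identityˡ (fall m n ℕ.* N)) ⟩
      i′ ⊗ (embℕ (fall m n ℕ.* N) ⊗ mono 1 cs)
        ≡⟨ cong₂ (λ f z → i′ ⊗ (f ⊗ z)) (embℕ-* (fall m n) N) (mono-dec n 1 cs e) ⟩
      i′ ⊗ ((f ⊗ embℕ N) ⊗ (T (suc n) ⊗ μ))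
        ≡⟨ cong (i′ ⊗_) (trans (⊗-assoc f (embℕ N) _) (cong (f ⊗_) (⊗-swap (embℕ N) (T (suc n)) μ))) ⟩
      i′ ⊗ (f ⊗ (T (suc n) ⊗ (embℕ N ⊗ μ)))
        ≡⟨ trans (⊗-swap i′ f _) (cong (f ⊗_) (⊗-swap i′ (T (suc n)) _)) ⟩
      reduced m n (dec n cs)
        ≡⟨ sym (1⊗ _ embℕ-1) ⟩
      embℕ 1 ⊗ reduced m n (dec n cs) ∎
      where
      N = Ncount (m ∸ n) (dec n cs)
      f = embℕ (fall m n)
      μ = mono 1 (dec n cs)
      i′ = [ n ℕ.+ weightFrom 1 (dec n cs) ≐ m ]
      same-weight : [ weightFrom 1 cs ≐ suc m ] ≡ i′
      same-weight with n ℕ.+ weightFrom 1 (dec n cs) ℕ.≟ m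
      ... | yes q = trans (≐-≡ (trans (weight-dec n 1 cs e) (cong suc q))) (sym (≐-≡ q))
      ... | no ¬q = trans (≐-≢ (λ q → ¬q (ℕₚ.suc-injective (trans (sym (weight-dec n 1 cs e)) q)))) (sym (≐-≢ ¬q))

    summand-suc : ∀ m cs → [ weightFrom 1 cs ≐ suc m ] ⊗ summand (suc m) cs ≡ ∑< (length cs) (λ n → embℕ (sg (get n cs)) ⊗ reduced m n (dec n cs))
    summand-suc m cs = trans expand (∑<-cong (length cs) (λ n _ → summand-slot m cs n))
      where
      i = [ weightFrom 1 cs ≐ suc m ]
      expand : i ⊗ summand (suc m) cs ≡ ∑< (length cs) (λ n → i ⊗ (embℕ (slot m cs n) ⊗ mono 1 cs))
      expand with weightFrom 1 cs ℕ.≟ suc m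
      ... | no ¬wt = trans (0⊗ (summand (suc m) cs) (≐-≢ ¬wt))
                       (sym (trans (∑<-cong (length cs) (λ n _ → 0⊗ (embℕ (slot m cs n) ⊗ mono 1 cs) (≐-≢ ¬wt))) (∑<-zero (length cs))))
      ... | yes wt = begin
        i ⊗ (embℕ (Ncount (suc m) cs) ⊗ mono 1 cs)                               ≡⟨ cong (λ z → i ⊗ (z ⊗ mono 1 cs)) (trans (cong embℕ (Ncount-rec m cs wt)) (embℕ-∑< (length cs) (slot m cs))) ⟩
        i ⊗ (∑< (length cs) (embℕ ∘ slot m cs) ⊗ mono 1 cs)                      ≡⟨ cong (i ⊗_) (sym (∑<-*ʳ (length cs) (mono 1 cs) _)) ⟩
        i ⊗ ∑< (length cs) (λ n → embℕ (slot m cs n) ⊗ mono 1 cs)                ≡⟨ sym (∑<-*ˡ (length cs) i _) ⟩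
        ∑< (length cs) (λ n → i ⊗ (embℕ (slot m cs n) ⊗ mono 1 cs))              ∎

    -- The bound on the entries of the vectors is never attained by a vector of weight m < K.
    ∑-reduced : ∀ K m n → m < K → ∑ (allVecs K K) (λ cs → embℕ (sg (K ∸ get n cs)) ⊗ reduced m n cs)
                ≡ embℕ (fall m n) ⊗ (T (suc n) ⊗ A[ K ] (m ∸ n))
    ∑-reduced K m n m<K = begin
      ∑ (allVecs K K) (λ cs → embℕ (sg (K ∸ get n cs)) ⊗ reduced m n cs)  ≡⟨ ∑-cong (allVecs K K) pointwise ⟩
      ∑ (allVecs K K) (λ cs → f ⊗ (T (suc n) ⊗ h cs))                     ≡⟨ ∑-*ˡ (allVecs K K) f _ ⟩
      f ⊗ ∑ (allVecs K K) (λ cs → T (suc n) ⊗ h cs)                       ≡⟨ cong (f ⊗_) (∑-*ˡ (allVecs K K) (T (suc n)) h) ⟩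
      f ⊗ (T (suc n) ⊗ A[ K ] (m ∸ n))                                    ∎
      where
      f = embℕ (fall m n)
      h : List ℕ → R
      h cs = [ weightFrom 1 cs ≐ m ∸ n ] ⊗ summand (m ∸ n) cs
      sg-pos : ∀ {k} → 0 < k → sg k ≡ 1
      sg-pos (s≤s _) = refl
      pointwise : ∀ cs → embℕ (sg (K ∸ get n cs)) ⊗ reduced m n cs ≡ f ⊗ (T (suc n) ⊗ h cs)
      pointwise cs with n ℕ.≤? m
      ... | no n≰m = trans (⊗0 (embℕ (sg (K ∸ get n cs))) (0⊗ _ f≡0)) (sym (0⊗ _ f≡0))
        where
        f≡0 : f ≡ 𝟘
        f≡0 = cong embℕ (fall-< (ℕₚ.≰⇒> n≰m))
      ... | yes n≤m with n ℕ.+ weightFrom 1 cs ℕ.≟ m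
      ...   | yes wt = trans (1⊗ (reduced m n cs) (trans (cong embℕ (sg-pos (ℕₚ.m<n⇒0<n∸m get<K))) embℕ-1))
                         (cong (λ i → f ⊗ (T (suc n) ⊗ (i ⊗ summand (m ∸ n) cs))) (trans (≐-≡ wt) (sym (≐-≡ wt′))))
        where
        wt′ : weightFrom 1 cs ≡ m ∸ n
        wt′ = sym (trans (cong (_∸ n) (sym wt)) (ℕₚ.m+n∸m≡n n _))
        get<K : get n cs < K
        get<K = ℕₚ.≤-<-trans (ℕₚ.≤-trans (get≤weight n 0 cs) (ℕₚ.≤-trans (ℕₚ.m≤n+m _ n) (ℕₚ.≤-reflexive wt))) m<K
      ...   | no ¬wt = trans (⊗0 (embℕ (sg (K ∸ get n cs))) (⊗0 f (⊗0 (T (suc n)) (0⊗ (summand (m ∸ n) cs) (≐-≢ ¬wt)))))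
                         (sym (⊗0 f (⊗0 (T (suc n)) (0⊗ (summand (m ∸ n) cs) (≐-≢ (λ wt′ → ¬wt (trans (cong (n ℕ.+_) wt′) (ℕₚ.m+[n∸m]≡n n≤m))))))))

    A[]-suc : ∀ K m → m < K → A[ K ] (suc m) ≡ ∑< K (λ n → embℕ (fall m n) ⊗ (T (suc n) ⊗ A[ K ] (m ∸ n)))
    A[]-suc K m m<K = begin
      A[ K ] (suc m)
        ≡⟨ ∑-allVecs-cong K K (λ { cs refl → summand-suc m cs }) ⟩
      ∑ (allVecs K K) (λ cs → ∑< K (λ n → embℕ (sg (get n cs)) ⊗ reduced m n (dec n cs)))
        ≡⟨ ∑-∑<-swap (allVecs K K) K _ ⟩
      ∑< K (λ n → ∑ (allVecs K K) (λ cs → embℕ (sg (get n cs)) ⊗ reduced m n (dec n cs)))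
        ≡⟨ ∑<-cong K (λ n n<K → trans (∑-dec n K K (reduced m n) n<K) (∑-reduced K m n m<K)) ⟩
      ∑< K (λ n → embℕ (fall m n) ⊗ (T (suc n) ⊗ A[ K ] (m ∸ n))) ∎

    A[]≡cyc : ∀ K M m → m ≤ M → m ≤ K → A[ K ] m ≡ cyc m
    A[]≡cyc K       M       zero    _         _         = A[]-zero K
    A[]≡cyc (suc K) (suc M) (suc m) (s≤s m≤M) (s≤s m≤K) = begin
      A[ suc K ] (suc m)
        ≡⟨ A[]-suc (suc K) m (s≤s m≤K) ⟩
      ∑< (suc K) (λ n → embℕ (fall m n) ⊗ (T (suc n) ⊗ A[ suc K ] (m ∸ n)))
        ≡⟨ ∑<-cong (suc K) (λ n _ → cong (λ z → embℕ (fall m n) ⊗ (T (suc n) ⊗ z))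
             (A[]≡cyc (suc K) M (m ∸ n) (ℕₚ.≤-trans (ℕₚ.m∸n≤m m n) m≤M) (ℕₚ.≤-trans (ℕₚ.m∸n≤m m n) (ℕₚ.m≤n⇒m≤1+n m≤K)))) ⟩
      ∑< (suc K) (cycTerm m 1)
        ≡⟨ sym (cycTail-∑ m 1 K m≤K) ⟩
      cyc (suc m) ∎

-- The cycle index over the quadratic ring, and conjugation.

module QuadraticCycleIndex (D : ℤ) where
  open RingR D
  open QuadraticRing D using (ringR)
  open module CI = CycleIndex (CommutativeRing.isCommutativeSemiring ringR) using (cyc; cycTail) public
  open CommutativeRing ringR using () renaming (+-identityˡ to ⊕-identityˡ; zeroˡ to ⊗-zeroˡ; *-identityˡ to ⊗-identityˡ)

  embℕ≡emb : ∀ T n → CI.embℕ T n ≡ emb (+ n)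
  embℕ≡emb T zero    = refl
  embℕ≡emb T (suc n) = cong (𝟙 ⊕_) (embℕ≡emb T n)

  cycTail-suc : ∀ T m i → cycTail T (suc m) i ≡ (T i ⊗ cyc T (suc m)) ⊕ (emb (+ suc m) ⊗ cycTail T m (suc i))
  cycTail-suc T m i = cong (λ z → (T i ⊗ cyc T (suc m)) ⊕ (z ⊗ cycTail T m (suc i))) (embℕ≡emb T (suc m))

  module _ (p : ℕ) {q : ℕ} (F : FiniteField q) (b : FiniteField.Carrier F) (u v w : ℤ[r]) where
    private T = t p F b u v w

    pow≡^ʳ : ∀ x c → CI.pow T x c ≡ x ^ʳ c
    pow≡^ʳ x zero    = refl
    pow≡^ʳ x (suc c) = cong (x ⊗_) (pow≡^ʳ x c)

    mono≡monoFrom : ∀ j cs → CI.mono T j cs ≡ monoFrom p F b u v w j cs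
    mono≡monoFrom j []       = refl
    mono≡monoFrom j (c ∷ cs) = cong₂ _⊗_ (pow≡^ʳ (T j) c) (mono≡monoFrom (suc j) cs)

    A≡cyc : ∀ k → A p F b u v w k ≡ cyc T k
    A≡cyc k = trans (go (allVecs k k)) (CI.A[]≡cyc T D k k k ℕₚ.≤-refl ℕₚ.≤-refl)
      where
      open Sums (CI.semiringR T) using (∑)
      go : ∀ css → foldr (λ cs acc → (emb (+ Ncount k cs) ⊗ monoFrom p F b u v w 1 cs) ⊕ acc) (emb 0ℤ)
                     (filter (λ cs → weightFrom 1 cs ℕ.≟ k) css)
           ≡ ∑ css (λ cs → CI.[_≐_] T D (weightFrom 1 cs) k ⊗ CI.summand T D k cs)
      go []         = refl
      go (cs ∷ css) with does (weightFrom 1 cs ℕ.≟ k)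
      ... | true  = cong₂ _⊕_ (trans (sym (cong₂ _⊗_ (embℕ≡emb T (Ncount k cs)) (mono≡monoFrom 1 cs))) (sym (⊗-identityˡ (CI.summand T D k cs)))) (go css)
      ... | false = trans (go css) (sym (trans (cong (_⊕ rest) (⊗-zeroˡ (CI.summand T D k cs))) (⊕-identityˡ rest)))
        where rest = ∑ css (λ cs → CI.[_≐_] T D (weightFrom 1 cs) k ⊗ CI.summand T D k cs)

  -- Replaces r by σ r: the identity for σ = 1, conjugation for σ = -1.
  twist : ℤ → ℤ[r] → ℤ[r]
  twist σ y = ⟨ re y + σ * im y r⟩

  module _ {σ : ℤ} (σ²≡1 : σ * σ ≡ 1ℤ) where

    twist-⊗ : ∀ x y → twist σ (x ⊗ y) ≡ twist σ x ⊗ twist σ y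
    twist-⊗ x y = cong₂ ⟨_+_r⟩
      (trans (one (re x * re y) (im x * im y * D)) (trans (cong (λ z → re x * re y + z * (im x * im y * D)) (sym σ²≡1)) (ring-re σ (re x) (re y) (im x) (im y) D)))
      (ring-im σ (re x) (re y) (im x) (im y))
      where
      one : ∀ a z → a + z ≡ a + 1ℤ * z
      one = solve-∀
      ring-re : ∀ σ a c b d D → a * c + σ * σ * (b * d * D) ≡ a * c + (σ * b) * (σ * d) * D
      ring-re = solve-∀
      ring-im : ∀ σ a c b d → σ * (a * d + b * c) ≡ a * (σ * d) + (σ * b) * c
      ring-im = solve-∀

    twist-⊕ : ∀ x y → twist σ (x ⊕ y) ≡ twist σ x ⊕ twist σ y
    twist-⊕ x y = cong (⟨_+_r⟩ _) (ℤₚ.*-distribˡ-+ σ (im x) (im y))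

    twist-emb : ∀ n → twist σ (emb n) ≡ emb n
    twist-emb n = cong ⟨ n +_r⟩ (ℤₚ.*-zeroʳ σ)

    module _ {T T′ : ℕ → ℤ[r]} (T′≡twist : ∀ j → T′ (suc j) ≡ twist σ (T (suc j))) where
      mutual
        -- `cyc` is an integer polynomial in `T 1`, `T 2` and so on, hence commutes with a ring
        -- homomorphism.
        cyc-twist : ∀ m → cyc T′ m ≡ twist σ (cyc T m)
        cyc-twist zero    = sym (twist-emb 1ℤ)
        cyc-twist (suc m) = cycTail-twist m 0

        cycTail-twist : ∀ m j → cycTail T′ m (suc j) ≡ twist σ (cycTail T m (suc j))
        cycTail-twist zero    j = trans (cong₂ _⊗_ (T′≡twist j) (cyc-twist 0)) (sym (twist-⊗ (T (suc j)) 𝟙))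
        cycTail-twist (suc m) j = trans (cycTail-suc T′ m (suc j))
          (trans (cong₂ _⊕_
            (trans (cong₂ _⊗_ (T′≡twist j) (cyc-twist (suc m))) (sym (twist-⊗ (T (suc j)) (cyc T (suc m)))))
            (trans (cong₂ _⊗_ (sym (twist-emb (+ suc m))) (cycTail-twist m (suc j))) (sym (twist-⊗ (emb (+ suc m)) (cycTail T m (suc (suc j)))))))
          (trans (sym (twist-⊕ (T (suc j) ⊗ cyc T (suc m)) (emb (+ suc m) ⊗ cycTail T m (suc (suc j))))) (cong (twist σ) (sym (cycTail-suc T m (suc j))))))

-- Evaluation of the tuple counts in the two components.

module Evaluation {q : ℕ} (F : FiniteField q) (2≢0 : ¬ FiniteField.ι F 2 ≡ FiniteField.0# F)
                  (p : ℕ) (∣⇒ι≡0 : ∀ {j} → p ∣ j → FiniteField.ι F j ≡ FiniteField.0# F)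
                  (∤⇒ι≢0 : ∀ {j} → ¬ p ∣ j → ¬ FiniteField.ι F j ≡ FiniteField.0# F) where
  open FieldProperties F
  open FiniteField F using (ι; χ)
  open IntegerSums F
  open QuadraticCharacter F 2≢0
  open DistinctTuples F
  open ≡-Reasoning

  -- The function f/q + a ([c = 0] - 1/q) + b χ(c), multiplied by q, for y = a + b r: these functions are closed
  -- under convolution with the distribution of i x², which acts on f by q - 1 and on y by multiplication.
  ev : ℤ → ℤ[r] → C → ℤ
  ev f y c = (f - re y) + + q * (re y * δ c 0ᶠ + im y * χ c)

  -- The negative of the second component of the power sum of index `j`. In k! e_k a permutation has
  -- the sign (-1)^(k - number of cycles); negating each power sum absorbs the cycles and leaves the
  -- global factor (-1)^k.
  τ : ℕ → ℤ[r]
  τ j with p ∣? j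
  ... | yes _ = ⟨ 1ℤ - + q + 0ℤ r⟩
  ... | no  _ = ⟨ 1ℤ + - χ (ι j) r⟩

  module _ (D : ℤ) (D≡εq : D ≡ ε * + q) where
    open RingR D
    open QuadraticCycleIndex D

    -- If `p` divides `i`, all values `i x²` are 0 and the shift is a multiplication by `q - 1`.
    -- Otherwise `squareShift-δ` and `squareShift-χ` express the result in the same three functions,
    -- and Q² becomes multiplication by r² = ε q.
    ev-shift : ∀ f y i c → ΣF (λ x → ν x * ev f y (c -ᶠ ι i *ᶠ (x *ᶠ x))) ≡ ev ((+ q - 1ℤ) * f) ((⊝ τ i) ⊗ y) c
    ev-shift f y i c with p ∣? i
    ... | yes p∣i = begin
      ΣF (λ x → ν x * ev f y (c -ᶠ ι i *ᶠ (x *ᶠ x)))     ≡⟨ ∑-cong elements (λ x → cong (λ z → ν x * ev f y z) (trans (cong (λ z → c -ᶠ z)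
                                                               (trans (cong (_*ᶠ (x *ᶠ x)) (∣⇒ι≡0 p∣i)) (zeroᶠˡ _))) (c-0 c))) ⟩
      ΣF (λ x → ν x * ev f y c)                          ≡⟨ ∑-*ʳ elements (ev f y c) ν ⟩
      ΣF ν * ev f y c                                    ≡⟨ cong (_* ev f y c) ΣF-ν₁ ⟩
      (+ q - 1ℤ) * ev f y c                              ≡⟨ algebra (+ q) f (re y) (im y) (δ c 0ᶠ) (χ c) D ⟩
      ev ((+ q - 1ℤ) * f) ((⊝ ⟨ 1ℤ - + q + 0ℤ r⟩) ⊗ y) c ∎
      where
      algebra : ∀ q f a b d x D → (q - 1ℤ) * ((f - a) + q * (a * d + b * x))
        ≡ ((q - 1ℤ) * f - (- (1ℤ - q) * a + - 0ℤ * b * D)) + q * ((- (1ℤ - q) * a + - 0ℤ * b * D) * d + (- (1ℤ - q) * b + - 0ℤ * a) * x)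
      algebra = solve-∀
    ... | no p∤i = begin
      ΣF (λ x → ν x * ev f y (c′ x))
        ≡⟨ ∑-cong elements (λ x → expand (ν x) f (re y) (im y) (+ q) (δ (c′ x) 0ᶠ) (χ (c′ x))) ⟩
      ΣF (λ x → (f - re y) * ν x + (+ q * re y * (ν x * δ (c′ x) 0ᶠ) + + q * im y * (ν x * χ (c′ x))))
        ≡⟨ trans (∑-+ elements _ _) (cong₂ _+_ (∑-*ˡ elements (f - re y) ν)
             (trans (∑-+ elements _ _) (cong₂ _+_ (∑-*ˡ elements (+ q * re y) (λ x → ν x * δ (c′ x) 0ᶠ))
                                                   (∑-*ˡ elements (+ q * im y) (λ x → ν x * χ (c′ x)))))) ⟩
      (f - re y) * ΣF ν + (+ q * re y * ΣF (λ x → ν x * δ (c′ x) 0ᶠ) + + q * im y * ΣF (λ x → ν x * χ (c′ x)))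
        ≡⟨ cong₂ (λ n z → (f - re y) * n + z) ΣF-ν₁ (cong₂ (λ d x → + q * re y * d + + q * im y * x) (squareShift-δ ιi≢0 c) (squareShift-χ ιi≢0 c)) ⟩
      (f - re y) * (+ q - 1ℤ) + (+ q * re y * ((1ℤ + χ (ι i) * χ c) - δ c 0ᶠ) + + q * im y * (χ (ι i) * (ε * (+ q * δ c 0ᶠ - 1ℤ)) - χ c))
        ≡⟨ algebra (+ q) f (re y) (im y) (δ c 0ᶠ) (χ c) (χ (ι i)) ε ⟩
      -- `ev′` is the target with `D` made a variable: the character sums produce `ε q`, whereas the
      -- ring multiplication is written with `D`.
      ev′ (ε * + q)
        ≡⟨ cong ev′ (sym D≡εq) ⟩
      ev ((+ q - 1ℤ) * f) ((⊝ ⟨ 1ℤ + - χ (ι i) r⟩) ⊗ y) c ∎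
      where
      ιi≢0 = ∤⇒ι≢0 p∤i
      c′ = λ x → c -ᶠ ι i *ᶠ (x *ᶠ x)
      ev′ : ℤ → ℤ
      ev′ D = ((+ q - 1ℤ) * f - (- 1ℤ * re y + - - χ (ι i) * im y * D))
            + + q * ((- 1ℤ * re y + - - χ (ι i) * im y * D) * δ c 0ᶠ + (- 1ℤ * im y + - - χ (ι i) * re y) * χ c)
      expand : ∀ n f a b q d x → n * ((f - a) + q * (a * d + b * x)) ≡ (f - a) * n + (q * a * (n * d) + q * b * (n * x))
      expand = solve-∀
      algebra : ∀ q f a b d x i e → (f - a) * (q - 1ℤ) + (q * a * ((1ℤ + i * x) - d) + q * b * (i * (e * (q * d - 1ℤ)) - x))
        ≡ ((q - 1ℤ) * f - (- 1ℤ * a + - - i * b * (e * q))) + q * ((- 1ℤ * a + - - i * b * (e * q)) * d + (- 1ℤ * b + - - i * a) * x)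
      algebra = solve-∀

    fallq : ℕ → ℤ
    fallq = falling (+ q - 1ℤ)

    mutual
      q*tuples : ∀ m c → + q * tuples m nonzero c ≡ ev (fallq m) (emb (sgn m) ⊗ cyc τ m) c
      q*tuples zero    c = algebra (+ q) (δ c 0ᶠ) (χ c) D
        where
        algebra : ∀ q d x D → q * d ≡ (1ℤ - (1ℤ * 1ℤ + 0ℤ * 0ℤ * D)) + q * ((1ℤ * 1ℤ + 0ℤ * 0ℤ * D) * d + (1ℤ * 0ℤ + 0ℤ * 1ℤ) * x)
        algebra = solve-∀
      q*tuples (suc m) c = trans (cong (+ q *_) (tuples≡marked m c)) (trans (q*marked m 1 c)
        (cong (λ y → ev (fallq (suc m)) y c) (negate (sgn m) (cycTail τ m 1))))
        where
        negate : ∀ s y → ⊝ (emb s ⊗ y) ≡ emb (- s) ⊗ y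
        negate s y = cong₂ ⟨_+_r⟩ (algebra-re s (re y) (im y) D) (algebra-im s (re y) (im y))
          where
          algebra-re : ∀ s a b D → - (s * a + 0ℤ * b * D) ≡ - s * a + 0ℤ * b * D
          algebra-re = solve-∀
          algebra-im : ∀ s a b → - (s * b + 0ℤ * a) ≡ - s * b + 0ℤ * a
          algebra-im = solve-∀

      -- `marked-suc` and `cycTail-suc` are the same recursion up to sign. In the first component it
      -- reads `(q - 1) f - (m + 1) f`, which adds the next factor of the falling factorial.
      q*marked : ∀ m i c → + q * marked m i c ≡ ev (fallq (suc m)) (⊝ (emb (sgn m) ⊗ cycTail τ m i)) c
      q*marked zero    i c = trans (q*∑ zero i c) (cong₂ (λ f y → ev f y c) (first (+ q)) (negate (τ i) 𝟙))
        where
        first : ∀ q → (q - 1ℤ) * 1ℤ ≡ 1ℤ * ((q - 1ℤ) - + 0)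
        first = solve-∀
        negate : ∀ x y → (⊝ x) ⊗ (emb 1ℤ ⊗ y) ≡ ⊝ (emb 1ℤ ⊗ (x ⊗ y))
        negate x y = cong₂ ⟨_+_r⟩ (algebra-re (re x) (im x) (re y) (im y) D) (algebra-im (re x) (im x) (re y) (im y) D)
          where
          algebra-re : ∀ a b c d D → - a * (1ℤ * c + 0ℤ * d * D) + - b * (1ℤ * d + 0ℤ * c) * D ≡ - (1ℤ * (a * c + b * d * D) + 0ℤ * (a * d + b * c) * D)
          algebra-re = solve-∀
          algebra-im : ∀ a b c d D → - a * (1ℤ * d + 0ℤ * c) + - b * (1ℤ * c + 0ℤ * d * D) ≡ - (1ℤ * (a * d + b * c) + 0ℤ * (a * c + b * d * D))
          algebra-im = solve-∀
      q*marked (suc m) i c = begin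
        + q * marked (suc m) i c
          ≡⟨ cong (+ q *_) (marked-suc m i c) ⟩
        + q * (S - + suc m * marked m (suc i) c)
          ≡⟨ distribute (+ q) S (+ suc m) (marked m (suc i) c) ⟩
        + q * S - + suc m * (+ q * marked m (suc i) c)
          ≡⟨ cong₂ (λ x y → x - + suc m * y) (q*∑ (suc m) i c) (q*marked m (suc i) c) ⟩
        ev ((+ q - 1ℤ) * f) ((⊝ τ i) ⊗ (emb (- s) ⊗ y)) c - + suc m * ev f (⊝ (emb s ⊗ z)) c
          ≡⟨ combine (+ q) (+ suc m) s f (re (τ i)) (im (τ i)) (re y) (im y) (re z) (im z) (δ c 0ᶠ) (χ c) D ⟩
        ev (fallq (suc (suc m))) (⊝ (emb (- s) ⊗ ((τ i ⊗ y) ⊕ (emb (+ suc m) ⊗ z)))) c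
          ≡⟨ cong (λ v → ev (fallq (suc (suc m))) (⊝ (emb (- s) ⊗ v)) c) (sym (cycTail-suc τ m i)) ⟩
        ev (fallq (suc (suc m))) (⊝ (emb (sgn (suc m)) ⊗ cycTail τ (suc m) i)) c ∎
        where
        S = ΣF (λ x → ν x * tuples (suc m) nonzero (c -ᶠ ι i *ᶠ (x *ᶠ x)))
        f = fallq (suc m)
        s = sgn m
        y = cyc τ (suc m)
        z = cycTail τ m (suc i)
        distribute : ∀ q S k M → q * (S - k * M) ≡ q * S - k * (q * M)
        distribute = solve-∀
        combine : ∀ q k s f t₁ t₂ y₁ y₂ z₁ z₂ d x D →
          (((q - 1ℤ) * f - (- t₁ * (- s * y₁ + 0ℤ * y₂ * D) + - t₂ * (- s * y₂ + 0ℤ * y₁) * D))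
             + q * ((- t₁ * (- s * y₁ + 0ℤ * y₂ * D) + - t₂ * (- s * y₂ + 0ℤ * y₁) * D) * d
                    + (- t₁ * (- s * y₂ + 0ℤ * y₁) + - t₂ * (- s * y₁ + 0ℤ * y₂ * D)) * x))
          - k * ((f - - (s * z₁ + 0ℤ * z₂ * D)) + q * (- (s * z₁ + 0ℤ * z₂ * D) * d + - (s * z₂ + 0ℤ * z₁) * x))
          ≡ (f * ((q - 1ℤ) - k) - - (- s * ((t₁ * y₁ + t₂ * y₂ * D) + (k * z₁ + 0ℤ * z₂ * D)) + 0ℤ * ((t₁ * y₂ + t₂ * y₁) + (k * z₂ + 0ℤ * z₁)) * D))
             + q * (- (- s * ((t₁ * y₁ + t₂ * y₂ * D) + (k * z₁ + 0ℤ * z₂ * D)) + 0ℤ * ((t₁ * y₂ + t₂ * y₁) + (k * z₂ + 0ℤ * z₁)) * D) * d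
                    + - (- s * ((t₁ * y₂ + t₂ * y₁) + (k * z₂ + 0ℤ * z₁)) + 0ℤ * ((t₁ * y₁ + t₂ * y₂ * D) + (k * z₁ + 0ℤ * z₂ * D))) * x)
        combine = solve-∀

      q*∑ : ∀ m i c → + q * ΣF (λ x → ν x * tuples m nonzero (c -ᶠ ι i *ᶠ (x *ᶠ x)))
            ≡ ev ((+ q - 1ℤ) * fallq m) ((⊝ τ i) ⊗ (emb (sgn m) ⊗ cyc τ m)) c
      q*∑ m i c = begin
        + q * ΣF (λ x → ν x * tuples m nonzero (c′ x))        ≡⟨ sym (∑-*ˡ elements (+ q) _) ⟩
        ΣF (λ x → + q * (ν x * tuples m nonzero (c′ x)))      ≡⟨ ∑-cong elements (λ x → trans (swap (+ q) (ν x) _) (cong (ν x *_) (q*tuples m (c′ x)))) ⟩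
        ΣF (λ x → ν x * ev (fallq m) (emb (sgn m) ⊗ cyc τ m) (c′ x)) ≡⟨ ev-shift (fallq m) _ i c ⟩
        ev ((+ q - 1ℤ) * fallq m) ((⊝ τ i) ⊗ (emb (sgn m) ⊗ cyc τ m)) c ∎
        where
        c′ = λ x → c -ᶠ ι i *ᶠ (x *ᶠ x)
        swap : ∀ a b c → a * (b * c) ≡ b * (a * c)
        swap = solve-∀

-- The counting formula for a nonzero target.

module CountingFormula {q : ℕ} (F : FiniteField q) (2≢0 : ¬ FiniteField.ι F 2 ≡ FiniteField.0# F)
                       (p : ℕ) (∣⇒ι≡0 : ∀ {j} → p ∣ j → FiniteField.ι F j ≡ FiniteField.0# F)
                       (∤⇒ι≢0 : ∀ {j} → ¬ p ∣ j → ¬ FiniteField.ι F j ≡ FiniteField.0# F)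
                       (b : FiniteField.Carrier F) (b≢0 : ¬ b ≡ FiniteField.0# F) where
  open FieldProperties F
  open FiniteField F using (ι; χ)
  open IntegerSums F
  open QuadraticCharacter F 2≢0
  open DistinctTuples F
  open Evaluation F 2≢0 p ∣⇒ι≡0 ∤⇒ι≢0
  open ≡-Reasoning

  χ≡±1 : ∀ {a} → ¬ a ≡ 0ᶠ → χ a ≡ 1ℤ ⊎ χ a ≡ -1ℤ
  χ≡±1 {a} a≢0 with χ-view a
  ... | zero a≡0 _      = contradiction a≡0 a≢0
  ... | square _ _ _ e  = inj₁ e
  ... | nonsquare _ _ e = inj₂ e

  module _ (D : ℤ) (D≡εq : D ≡ ε * + q) where
    open RingR D
    open QuadraticCycleIndex D

    w : ℤ[r]
    w = emb (1ℤ - + q)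

    -- The indeterminates of A are u, v according to the sign of χ(j) χ(b), so A is a twist of the cycle index of τ.
    A≡twist : ∀ e → e ≡ 1ℤ ⊎ e ≡ -1ℤ → ∀ k →
              A p F b ⟨ 1ℤ + - e r⟩ ⟨ 1ℤ + e r⟩ w k ≡ twist (e * χ b) (cyc τ k)
    A≡twist e e≡±1 k = trans (A≡cyc p F b ⟨ 1ℤ + - e r⟩ ⟨ 1ℤ + e r⟩ w k)
      (cyc-twist {e * χ b} σ²≡1 {τ} {t p F b ⟨ 1ℤ + - e r⟩ ⟨ 1ℤ + e r⟩ w} (λ j → t≡twist (suc j)) k)
      where
      square-±1 : ∀ {x} → x ≡ 1ℤ ⊎ x ≡ -1ℤ → x * x ≡ 1ℤ
      square-±1 (inj₁ refl) = refl
      square-±1 (inj₂ refl) = refl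
      regroup : ∀ e x → (e * x) * (e * x) ≡ (e * e) * (x * x)
      regroup = solve-∀
      σ²≡1 : (e * χ b) * (e * χ b) ≡ 1ℤ
      σ²≡1 = trans (regroup e (χ b)) (cong₂ _*_ (square-±1 e≡±1) (square-±1 (χ≡±1 b≢0)))
      t≡twist : ∀ j → t p F b ⟨ 1ℤ + - e r⟩ ⟨ 1ℤ + e r⟩ w j ≡ twist (e * χ b) (τ j)
      t≡twist j with p ∣? j
      ... | yes _ = cong ⟨ 1ℤ - + q +_r⟩ (sym (ℤₚ.*-zeroʳ (e * χ b)))
      ... | no p∤j with χ (ι j) ℤ.≟ χ b
      ...   | yes χj≡χb = cong ⟨ 1ℤ +_r⟩ (begin
        - e                           ≡⟨ sym (ℤₚ.*-identityʳ (- e)) ⟩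
        - e * 1ℤ                      ≡⟨ cong (- e *_) (sym (square-±1 (χ≡±1 b≢0))) ⟩
        - e * (χ b * χ b)             ≡⟨ rearrange e (χ b) ⟩
        (e * χ b) * - χ b             ≡⟨ cong (λ x → (e * χ b) * - x) (sym χj≡χb) ⟩
        (e * χ b) * - χ (ι j)         ∎)
        where
        rearrange : ∀ e x → - e * (x * x) ≡ (e * x) * - x
        rearrange = solve-∀
      ...   | no χj≢χb = cong ⟨ 1ℤ +_r⟩ (trans (sym (ℤₚ.*-identityʳ e))
                           (trans (cong (e *_) (sym (opposite (χ≡±1 b≢0) (χ≡±1 (∤⇒ι≢0 p∤j))))) (sym (ℤₚ.*-assoc e (χ b) _))))
        where
        opposite : χ b ≡ 1ℤ ⊎ χ b ≡ -1ℤ → χ (ι j) ≡ 1ℤ ⊎ χ (ι j) ≡ -1ℤ → χ b * - χ (ι j) ≡ 1ℤ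
        opposite (inj₁ x) (inj₁ y) = contradiction (trans y (sym x)) χj≢χb
        opposite (inj₁ x) (inj₂ y) = cong₂ (λ a c → a * - c) x y
        opposite (inj₂ x) (inj₁ y) = cong₂ (λ a c → a * - c) x y
        opposite (inj₂ x) (inj₂ y) = contradiction (trans y (sym x)) χj≢χb

    -- At `b`, which is not 0, the delta term of `ev` drops out. The factor 2 prepares for adding
    -- two conjugate terms.
    2q*Nstar : ∀ k → + 2 * + q * + Nstar F k b
               ≡ + 2 * falling (+ q - 1ℤ) k - sgn k * (+ 2 * (re (cyc τ k) - + q * (χ b * im (cyc τ k))))
    2q*Nstar k = begin
      + 2 * + q * + Nstar F k b                     ≡⟨ ℤₚ.*-assoc (+ 2) (+ q) (+ Nstar F k b) ⟩
      + 2 * (+ q * + Nstar F k b)                   ≡⟨ cong (λ z → + 2 * (+ q * z)) (Nstar≡tuples k b) ⟩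
      + 2 * (+ q * tuples k nonzero b)              ≡⟨ cong (+ 2 *_) (q*tuples D D≡εq k b) ⟩
      + 2 * ev (falling (+ q - 1ℤ) k) (emb (sgn k) ⊗ cyc τ k) b
        ≡⟨ cong (λ d → + 2 * ((falling (+ q - 1ℤ) k - re y) + + q * (re y * d + im y * χ b))) (δ-≢ b≢0) ⟩
      + 2 * ((falling (+ q - 1ℤ) k - re y) + + q * (re y * 0ℤ + im y * χ b))
        ≡⟨ algebra (falling (+ q - 1ℤ) k) (sgn k) (+ q) (re (cyc τ k)) (im (cyc τ k)) (χ b) D ⟩
      + 2 * falling (+ q - 1ℤ) k - sgn k * (+ 2 * (re (cyc τ k) - + q * (χ b * im (cyc τ k)))) ∎
      where
      y = emb (sgn k) ⊗ cyc τ k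
      algebra : ∀ f s q a g x D → + 2 * ((f - (s * a + 0ℤ * g * D)) + q * ((s * a + 0ℤ * g * D) * 0ℤ + (s * g + 0ℤ * a) * x))
                ≡ + 2 * f - s * (+ 2 * (a - q * (x * g)))
      algebra = solve-∀

    -- Both cases of the theorem at once: the arguments of `A` agree in them, and only the outer
    -- coefficients `1 - e r` and `1 + e r` change places with the sign `e`.
    Formula : ℤ → ℕ → Set
    Formula e k = emb (+ 2 * + q * + Nstar F k b)
      ≡ emb (+ 2 * falling (+ q - 1ℤ) k)
        ⊖ emb (sgn k) ⊗ (⟨ 1ℤ + - e r⟩ ⊗ A p F b ⟨ 1ℤ + -1ℤ r⟩ ⟨ 1ℤ + 1ℤ r⟩ w k
                         ⊕ ⟨ 1ℤ + e r⟩ ⊗ A p F b ⟨ 1ℤ + 1ℤ r⟩ ⟨ 1ℤ + -1ℤ r⟩ w k)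

    -- Let `cyc τ k` be a + g r and x = χ(b). Then (1 - e r)(a + x g r) + (1 + e r)(a - x g r) = 2
    -- (a - e D x g): the multiples of r cancel, and e D = q gives the expression in `2q*Nstar`.
    formula : ∀ e → e * D ≡ + q → ∀ k → Formula e k
    formula e eD≡q k = begin
      emb (+ 2 * + q * + Nstar F k b)
        ≡⟨ cong emb (2q*Nstar k) ⟩
      emb (+ 2 * f - s * (+ 2 * (a - + q * (χ b * g))))
        ≡⟨ cong (λ z → emb (+ 2 * f - s * (+ 2 * (a - z * (χ b * g))))) (sym eD≡q) ⟩
      emb (+ 2 * f - s * (+ 2 * (a - (e * D) * (χ b * g))))
        ≡⟨ cong₂ ⟨_+_r⟩ (algebra-re f s a g (χ b) e D) (algebra-im s a g (χ b) e D) ⟩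
      emb (+ 2 * f) ⊖ emb s ⊗ (⟨ 1ℤ + - e r⟩ ⊗ twist (1ℤ * χ b) (cyc τ k) ⊕ ⟨ 1ℤ + e r⟩ ⊗ twist (-1ℤ * χ b) (cyc τ k))
        ≡⟨ cong₂ (λ x y → emb (+ 2 * f) ⊖ emb s ⊗ (⟨ 1ℤ + - e r⟩ ⊗ x ⊕ ⟨ 1ℤ + e r⟩ ⊗ y))
             (sym (A≡twist 1ℤ (inj₁ refl) k)) (sym (A≡twist -1ℤ (inj₂ refl) k)) ⟩
      emb (+ 2 * f) ⊖ emb s ⊗ (⟨ 1ℤ + - e r⟩ ⊗ A p F b ⟨ 1ℤ + -1ℤ r⟩ ⟨ 1ℤ + 1ℤ r⟩ w k
                               ⊕ ⟨ 1ℤ + e r⟩ ⊗ A p F b ⟨ 1ℤ + 1ℤ r⟩ ⟨ 1ℤ + -1ℤ r⟩ w k) ∎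
      where
      f = falling (+ q - 1ℤ) k
      s = sgn k
      a = re (cyc τ k)
      g = im (cyc τ k)
      algebra-re : ∀ f s a g x e D → + 2 * f - s * (+ 2 * (a - (e * D) * (x * g)))
        ≡ + 2 * f + - (s * ((1ℤ * a + - e * ((1ℤ * x) * g) * D) + (1ℤ * a + e * ((-1ℤ * x) * g) * D))
                     + 0ℤ * ((1ℤ * ((1ℤ * x) * g) + - e * a) + (1ℤ * ((-1ℤ * x) * g) + e * a)) * D)
      algebra-re = solve-∀
      algebra-im : ∀ s a g x e D → 0ℤ
        ≡ 0ℤ + - (s * ((1ℤ * ((1ℤ * x) * g) + - e * a) + (1ℤ * ((-1ℤ * x) * g) + e * a))
                + 0ℤ * ((1ℤ * a + - e * ((1ℤ * x) * g) * D) + (1ℤ * a + e * ((-1ℤ * x) * g) * D)))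
      algebra-im = solve-∀

-- Residues modulo 4, the sign of χ(-1), and the theorem.

pow%4≡1 : ∀ p s → p % 4 ≡ 1 → (p ^ s) % 4 ≡ 1
pow%4≡1 p zero    _ = refl
pow%4≡1 p (suc s) e = trans (%-distribˡ-* p (p ^ s) 4) (cong₂ (λ x y → (x ℕ.* y) % 4) e (pow%4≡1 p s e))

pow%4≡3 : ∀ p s → p % 4 ≡ 3 → s % 2 ≡ 1 → (p ^ s) % 4 ≡ 3
pow%4≡1′ : ∀ p s → p % 4 ≡ 3 → s % 2 ≡ 0 → (p ^ s) % 4 ≡ 1
pow%4≡3 p (suc zero)    e _ = trans (cong (_% 4) (ℕₚ.*-identityʳ p)) e
pow%4≡3 p (suc (suc s)) e o = trans (%-distribˡ-* p (p ^ suc s) 4)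
  (cong₂ (λ x y → (x ℕ.* y) % 4) e (pow%4≡1′ p (suc s) e (parity s o)))
  where
  parity : ∀ s → s % 2 ≡ 1 → suc s % 2 ≡ 0
  parity (suc zero)    _ = refl
  parity (suc (suc s)) o = parity s o
pow%4≡1′ p zero          e _ = refl
pow%4≡1′ p (suc (suc s)) e o = trans (%-distribˡ-* p (p ^ suc s) 4)
  (cong₂ (λ x y → (x ℕ.* y) % 4) e (pow%4≡3 p (suc s) e (parity s o)))
  where
  parity : ∀ s → s % 2 ≡ 0 → suc s % 2 ≡ 1
  parity zero          _ = refl
  parity (suc (suc s)) o = parity s o

-- Excludes the wrong sign of `ε`, which would shift the congruence modulo 4 by 2.
4x≢±2 : ∀ x → ¬ ∣ + 4 * x ∣ ≡ 2
4x≢±2 x e = go ∣ x ∣ (trans (sym (ℤₚ.abs-* (+ 4) x)) e)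
  where
  go : ∀ n → ¬ 4 ℕ.* n ≡ 2
  go zero    ()
  go (suc n) e = contradiction (ℕₚ.≤-trans (ℕₚ.m≤m+n 4 _) (ℕₚ.≤-reflexive (trans (sym (ℕₚ.*-suc 4 n)) e))) λ { (s≤s (s≤s ())) }

module PrimePowerField (p s : ℕ) (pr : Prime p) (odd : p % 2 ≡ 1) (F : FiniteField (p ^ s)) where
  open FieldProperties F using (0ᶠ)
  open FiniteField F using (ι)
  open Characteristic F

  ιp≡0 : ι p ≡ 0ᶠ
  ιp≡0 = ι[m^n]≡0 p s ιq≡0

  ∤2 : ∀ p → Prime p → p % 2 ≡ 1 → ¬ p ∣ 2
  ∤2 (suc zero)          pr _  _    = ¬prime[1] pr
  ∤2 (suc (suc zero))    _  () _
  ∤2 (suc (suc (suc p))) _  _  p∣2 with ∣⇒≤ p∣2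
  ... | s≤s (s≤s ())

  2≢0 : ¬ ι 2 ≡ 0ᶠ
  2≢0 = ι-∤ pr ιp≡0 (∤2 p pr odd)

  open QuadraticCharacter F 2≢0 public using (ε; ε≡±1; -ε≡q-2[mod4])

  private
    q = p ^ s
    M = proj₁ -ε≡q-2[mod4]
    X = + (q ℕ./ 4) + M

  q≡ : ∀ {c} → q % 4 ≡ c → + q ≡ + c + + 4 * + (q ℕ./ 4)
  q≡ {c} e = trans (cong +_ (trans (m≡m%n+[m/n]*n q 4) (cong₂ ℕ._+_ e (ℕₚ.*-comm (q ℕ./ 4) 4))))
    (trans (ℤₚ.pos-+ c (4 ℕ.* (q ℕ./ 4))) (cong (λ z → + c + z) (ℤₚ.pos-* 4 (q ℕ./ 4))))

  -ε≡ : ∀ {c} → q % 4 ≡ c → - ε ≡ + c - + 2 + + 4 * X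
  -ε≡ {c} e = trans (proj₂ -ε≡q-2[mod4]) (trans (cong (λ z → z - + 2 + + 4 * M) (q≡ e)) (regroup (+ c) (+ (q ℕ./ 4)) M))
    where
    regroup : ∀ c a M → c + + 4 * a - + 2 + + 4 * M ≡ c - + 2 + + 4 * (a + M)
    regroup = solve-∀

  isolate : ∀ c x → x ≡ (c + x) - c
  isolate = solve-∀

  -- Now `- ε` is -1 + 4 X, so `ε = -1` would make 4 X equal to 2.
  ε≡1 : q % 4 ≡ 1 → ε ≡ 1ℤ
  ε≡1 e with ε≡±1
  ... | inj₁ ε≡1  = ε≡1
  ... | inj₂ ε≡-1 = contradiction (cong ∣_∣ (trans (isolate -1ℤ (+ 4 * X)) (cong (λ z → z - -1ℤ) (trans (sym (-ε≡ e)) (cong -_ ε≡-1)))))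
                      (4x≢±2 X)

  ε≡-1 : q % 4 ≡ 3 → ε ≡ -1ℤ
  ε≡-1 e with ε≡±1
  ... | inj₂ ε≡-1 = ε≡-1
  ... | inj₁ ε≡1  = contradiction (cong ∣_∣ (trans (isolate 1ℤ (+ 4 * X)) (cong (λ z → z - 1ℤ) (trans (sym (-ε≡ e)) (cong -_ ε≡1)))))
                      (4x≢±2 X)

  module ForTarget (b : FiniteField.Carrier F) (b≢0 : ¬ b ≡ 0ᶠ) = CountingFormula F 2≢0 p (ι-∣ ιp≡0) (ι-∤ pr ιp≡0) b b≢0

open import Defs using (Carrier; 0#)

theorem4p5 : (p s k : ℕ) → Prime p → p % 2 ≡ 1 → 1 ≤ s → 1 ≤ k →
    (F : FiniteField (p ^ s)) → (b : Carrier F) → ¬ (b ≡ 0# F) →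
    ((p % 4 ≡ 1 ⊎ (p % 4 ≡ 3 × s % 2 ≡ 0)) →
    let open RingR (+ (p ^ s)) in
    emb (+ 2 * + (p ^ s) * + Nstar F k b)
    ≡ emb (+ 2 * falling (+ (p ^ s) - + 1) k)
    ⊖ emb (sgn k) ⊗ ((𝟙 ⊖ rt) ⊗ A p F b (𝟙 ⊖ rt) (𝟙 ⊕ rt) (emb (+ 1 - + (p ^ s))) k
    ⊕ (𝟙 ⊕ rt) ⊗ A p F b (𝟙 ⊕ rt) (𝟙 ⊖ rt) (emb (+ 1 - + (p ^ s))) k))
    × ((p % 4 ≡ 3 × s % 2 ≡ 1) →
    let open RingR (Data.Integer.- + (p ^ s)) in
    emb (+ 2 * + (p ^ s) * + Nstar F k b)
    ≡ emb (+ 2 * falling (+ (p ^ s) - + 1) k)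
    ⊖ emb (sgn k) ⊗ ((𝟙 ⊕ rt) ⊗ A p F b (𝟙 ⊖ rt) (𝟙 ⊕ rt) (emb (+ 1 - + (p ^ s))) k
    ⊕ (𝟙 ⊖ rt) ⊗ A p F b (𝟙 ⊕ rt) (𝟙 ⊖ rt) (emb (+ 1 - + (p ^ s))) k))
theorem4p5 p s k pr odd _ _ F b b≢0 =
    -- In both cases the sign passed for `e` is the value of `ε`, so that D = e q and e D = q.
    (λ h → formula (+ q) (trans (sym (ℤₚ.*-identityˡ (+ q))) (cong (_* + q) (sym (ε≡1 (q%4≡1 h)))))
             1ℤ (ℤₚ.*-identityˡ (+ q)) k)
  , (λ (e , o) → formula (- + q) (trans (sym (ℤₚ.-1*i≡-i (+ q))) (cong (_* + q) (sym (ε≡-1 (pow%4≡3 p s e o)))))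
             -1ℤ (trans (ℤₚ.-1*i≡-i (- + q)) (ℤₚ.neg-involutive (+ q))) k)
  where
  open PrimePowerField p s pr odd F
  open ForTarget b b≢0 using (formula)

  q = p ^ s

  q%4≡1 : p % 4 ≡ 1 ⊎ (p % 4 ≡ 3 × s % 2 ≡ 0) → q % 4 ≡ 1
  q%4≡1 (inj₁ e)       = pow%4≡1 p s e
  q%4≡1 (inj₂ (e , o)) = pow%4≡1′ p s e o
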